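{- For $n\ge2$ let $U=\{1,\dots,n\}$, introduce an auxiliary vertex $z_{ij}$ for every pair $1\le i<j\le n$, and let $H_n$ be the $3$-uniform hypergraph on $V_n=U\cup\{z_{ij}:1\le i<j\le n\}$ with hyperedges $\{i,j,z_{ij}\}$, $1\le i<j\le n$; let $N=|V_n|=\Theta(n^2)$. Let $\mathcal M_{\mathrm{sw}}(H_n)$ be the homomorphism marginal polytope of the $\mathrm{NAE}_3$ switch instance built from $H_n$, with singleton coordinates for the two shared gate variables $r,z$ included. Then the face of $\mathcal M_{\mathrm{sw}}(H_n)$ defined by $r=0$, $z=1$ projects onto $\mathcal F_{H_n}$. Hence $$\mathrm{xc}\bigl(\mathcal M_{\mathrm{sw}}(H_n)\bigr)\ge2^{\Omega(n)}=2^{\Omega(\sqrt N)} .$$ Thus the fixed gated $\mathrm{NAE}_3$ template (the switch template) also has no width-independent polynomial-size exact marginal formulation.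
   Context: For a finite set $V$ and $S\subseteq V$, the cut vector $\delta_S$ is indexed by the unordered pairs of distinct elements of $V$, with $\delta_S(uv)=1$ if exactly one of $u,v$ lies in $S$ and $0$ otherwise; $\mathrm{CUT}(V)=\mathrm{conv}\{\delta_S:S\subseteq V\}$ is the cut polytope. The proper-cut face is $\mathcal F_{H_n}:=\{x\in\mathrm{CUT}(V_n): x_{ij}+x_{iz_{ij}}+x_{jz_{ij}}=2\text{ for all }1\le i<j\le n\}$. $\mathrm{xc}(P)$ is the extension complexity of a polytope $P$: the minimum number of facets of a polytope having $P$ as an image under a linear (affine) map. $\mathrm{NAE}_3=\{0,1\}^3\setminus\{000,111\}$. The switch relation on $\{0,1\}$ is $\mathsf S(r,z,x,y,w)\iff(z=r)$ or ($z\neq r$ and $\mathrm{NAE}_3(x,y,w)$). The fixed gated $\mathrm{NAE}_3$ template (switch template) has this five-ary relation $\mathsf S$ as its relation, with probability table $\vartheta U_0+(1-\vartheta)U_1$ for a fixed rational $\vartheta\in(0,1)$, where $U_0$ is uniform on the $16$ tuples of $\mathsf S$ with $z=r$ and $U_1$ is uniform on the $12$ tuples of $\mathsf S$ with $z\ne r$. The switch instance of a $3$-uniform hypergraph $H$ has as variables the vertices of $H$ and two shared gate variables $r,z$ (the gate $z$ is distinct from the vertices $z_{ij}$), with one constraint $\mathsf S(r,z,v_1,v_2,v_3)$ per hyperedge (ordered as $(v_1,v_2,v_3)$). Its homomorphisms $h$ are the $\{0,1\}$-assignments to all variables satisfying all constraints. For each homomorphism $h$, $M(h)$ is the $0$–$1$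 vector recording every relation event selected by $h$, that is, with one coordinate for every pair (constraint $c$, tuple $\mathbf b\in\mathsf S$), equal to $1$ iff $h$ maps the scope of $c$ to $\mathbf b$; here singleton coordinates recording the values of the gate variables $r$ and $z$ are also included. $\mathcal M_{\mathrm{sw}}(H)=\mathrm{conv}\{M(h)\}$ over all homomorphisms $h$ of the switch instance of $H$. The face $r=0$, $z=1$ is the set of points of $\mathcal M_{\mathrm{sw}}(H)$ where the singleton coordinates of the events $r=0$ and $z=1$ both equal $1$. "Width" refers to the treewidth of the primal graph of an instance, in which two variables are joined when they occur in a common constraint; the final sentence says that there is no universal compact (polynomial-size, with no restriction on width) exact linear-programming formulation of the full homomorphism marginal polytopes of instances over this template.
   Formalization: The face r=0, z=1 is shown to project onto the proper-cut face only in the coordinates of pairs lying in a common hyperedge; onto all pair coordinates of V_n the claim fails for large n, since the proper-cut face then has larger dimension than the marginal polytope. -}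

module Defs where

open import Algebra.Apartness.Bundles using (HeytingField)
open import Algebra.Bundles using (CommutativeRing)
open import Data.Bool using (Bool; true; false; if_then_else_; not; _∧_; _∨_; _xor_; T)
open import Data.Bool.Properties using (T?)
open import Data.Empty.Irrelevant using (⊥-elim)
open import Data.Fin as Fin using (Fin; zero; suc; _↑ʳ_)
import Data.Fin.Properties as Fin
open import Data.Integer using (+_)
open import Data.List as List using (List; []; _∷_)
open import Data.Maybe as Maybe using (Maybe)
open import Data.Nat as ℕ using (ℕ)
open import Data.Product using (Σ-syntax; ∃-syntax; _×_; _,_)
open import Data.Rational as ℚ using (ℚ; 0ℚ; 1ℚ)
open import Data.Sum using (_⊎_)
open import Data.Vec as Vec using (Vec; []; _∷_)
import Data.Vec.Properties as Vec
import Data.Bool.Properties as Bool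
open import Function using (_∘_)
open import Function.Definitions using (Injective)
open import Level using (Level; _⊔_) renaming (suc to lsuc)
open import Relation.Binary.Core using (Rel)
open import Relation.Binary.Structures using (IsStrictPartialOrder)
open import Relation.Binary.PropositionalEquality using (_≡_; _≢_; refl; cong)
open import Relation.Nullary using (¬_)
open import Relation.Nullary.Decidable using (does; dec⇒maybe)
open import Relation.Unary using (Pred; _⊆_; _≐_)

-- f = Θ(g): real constants may be replaced by a single natural one.
IsΘ : (f g : ℕ → ℕ) → Set
IsΘ f g = ∃[ C ] ∃[ n₀ ] (∀ n → n₀ ℕ.≤ n → (f n ℕ.≤ C ℕ.* g n) × (g n ℕ.≤ C ℕ.* f n))

-- The real inequality 2 ^ √m ≤ k, tested at every rational p/q ≤ √m.
2^√_≤_ : ℕ → ℕ → Set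
2^√ m ≤ k = ∀ p q → p ℕ.* p ℕ.≤ q ℕ.* q ℕ.* m → 2 ℕ.^ p ℕ.≤ k ℕ.^ q

-- An unordered pair {u , v} is given by either of its two orientations.  The
-- cut vectors, and so all points of a cut polytope, agree on both.
record Pair (V : Set) : Set where
  constructor pair
  field
    fst snd   : V
    .distinct : fst ≢ snd

mapPair : {A B : Set} (f : A → B) → Injective _≡_ _≡_ f → Pair A → Pair B
mapPair f inj (pair a b a≢b) = pair (f a) (f b) (λ eq → a≢b (inj eq))

-- Every hyperedge comes with an order on its three vertices.
record Hypergraph₃ : Set₁ where
  field
    V E      : Set
    vertex   : E → Fin 3 → V
    distinct : ∀ e → Injective _≡_ _≡_ (vertex e)
    simple   : ∀ e e′ → (∀ k → ∃[ l ] vertex e k ≡ vertex e′ l) → e ≡ e′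

record Pair< (n : ℕ) : Set where
  constructor pair<
  field
    i j  : Fin n
    .i<j : i Fin.< j

data Vertex (n : ℕ) : Set where
  u : Fin n → Vertex n
  z : Pair< n → Vertex n

hyperedge : ∀ {n} → Pair< n → Fin 3 → Vertex n
hyperedge e zero             = u (Pair<.i e)
hyperedge e (suc zero)       = u (Pair<.j e)
hyperedge e (suc (suc zero)) = z e

hyperedge-injective : ∀ {n} (e : Pair< n) → Injective _≡_ _≡_ (hyperedge e)
hyperedge-injective e              {zero}           {zero}           _    = refl
hyperedge-injective (pair< _ _ lt) {zero}           {suc zero}       refl = ⊥-elim (Fin.<-irrefl refl lt)
hyperedge-injective e              {zero}           {suc (suc zero)} ()
hyperedge-injective (pair< _ _ lt) {suc zero}       {zero}           refl = ⊥-elim (Fin.<-irrefl refl lt)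
hyperedge-injective e              {suc zero}       {suc zero}       _    = refl
hyperedge-injective e              {suc zero}       {suc (suc zero)} ()
hyperedge-injective e              {suc (suc zero)} {zero}           ()
hyperedge-injective e              {suc (suc zero)} {suc zero}       ()
hyperedge-injective e              {suc (suc zero)} {suc (suc zero)} _    = refl

hyperedge-simple : ∀ {n} (e e′ : Pair< n) → (∀ k → ∃[ l ] hyperedge e k ≡ hyperedge e′ l) → e ≡ e′
hyperedge-simple e e′ sub with sub (suc (suc zero))
... | suc (suc zero) , refl = refl

H : ℕ → Hypergraph₃
H n = record
  { V        = Vertex n
  ; E        = Pair< n
  ; vertex   = hyperedge
  ; distinct = hyperedge-injective
  ; simple   = hyperedge-simple
  }

-- The pairs of vertices that lie in a common hyperedge, presented by the
-- hyperedge and two of its three positions.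
CoveredPair : Hypergraph₃ → Set
CoveredPair G = Hypergraph₃.E G × Pair (Fin 3)

coveredPair : (G : Hypergraph₃) → CoveredPair G → Pair (Hypergraph₃.V G)
coveredPair G (e , p) = mapPair (Hypergraph₃.vertex G e) (Hypergraph₃.distinct G e) p

record Template : Set where
  field
    arity    : ℕ
    relation : Vec Bool arity → Bool
    table    : Vec Bool arity → ℚ

record Tuple (𝕋 : Template) : Set where
  constructor tuple
  field
    entries   : Vec Bool (Template.arity 𝕋)
    .satisfies : T (Template.relation 𝕋 entries)

allVectors : ∀ n → List (Vec Bool n)
allVectors ℕ.zero    = [] ∷ []
allVectors (ℕ.suc n) = List.cartesianProductWith _∷_ (false ∷ true ∷ []) (allVectors n)

tuples : (𝕋 : Template) → List (Tuple 𝕋)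
tuples 𝕋 = List.mapMaybe
  (λ b → Maybe.map (λ sat → tuple b sat) (dec⇒maybe (T? (Template.relation 𝕋 b))))
  (allVectors (Template.arity 𝕋))

record Instance (𝕋 : Template) : Set₁ where
  field
    Var   : Set
    Con   : Set
    scope : Con → Vec Var (Template.arity 𝕋)

record Hom {𝕋 : Template} (I : Instance 𝕋) : Set where
  open Instance I
  field
    value     : Var → Bool
    satisfies : ∀ c → T (Template.relation 𝕋 (Vec.map value (scope c)))

-- Coordinates of the marginal polytope: all relation events, and the singleton
-- events of those variables that W selects.
data Event {𝕋 : Template} (I : Instance 𝕋) (W : Instance.Var I → Bool) : Set where
  relationEvent  : Instance.Con I → Tuple 𝕋 → Event I W
  singletonEvent : (v : Instance.Var I) → .(T (W v)) → Bool → Event I W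

equal : Bool → Bool → Bool
equal a b = not (a xor b)

NAE₃ : Bool → Bool → Bool → Bool
NAE₃ x y w = not (x ∧ y ∧ w) ∧ not (not x ∧ not y ∧ not w)

-- Here and below, s is the value of the gate variable z.
switch : Vec Bool 5 → Bool
switch (r ∷ s ∷ x ∷ y ∷ w ∷ []) = equal s r ∨ (not (equal s r) ∧ NAE₃ x y w)

-- Uniform on the 16 tuples of the relation with s = r, respectively the 12 with
-- s ≠ r.
U₀ U₁ : Vec Bool 5 → ℚ
U₀ (r ∷ s ∷ x ∷ y ∷ w ∷ []) = if equal s r then + 1 ℚ./ 16 else 0ℚ
U₁ (r ∷ s ∷ x ∷ y ∷ w ∷ []) = if not (equal s r) ∧ NAE₃ x y w then + 1 ℚ./ 12 else 0ℚ

switchTemplate : ℚ → Template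
switchTemplate ϑ = record
  { arity    = 5
  ; relation = switch
  ; table    = λ b → ϑ ℚ.* U₀ b ℚ.+ (1ℚ ℚ.- ϑ) ℚ.* U₁ b
  }

data SwitchVar (V : Set) : Set where
  gate-r gate-z : SwitchVar V
  vertexVar     : V → SwitchVar V

isGate : {V : Set} → SwitchVar V → Bool
isGate gate-r        = true
isGate gate-z        = true
isGate (vertexVar _) = false

switchInstance : (ϑ : ℚ) → Hypergraph₃ → Instance (switchTemplate ϑ)
switchInstance ϑ G = record
  { Var   = SwitchVar V
  ; Con   = E
  ; scope = λ e → gate-r ∷ gate-z ∷ Vec.map vertexVar (Vec.tabulate (vertex e))
  }
  where open Hypergraph₃ G

-- Constructive ordered fields.  With excluded middle (_#_ is then the negation
-- of _≈_) these are exactly the ordered fields; the real numbers are an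
-- instance both classically and constructively.
record OrderedField (c ℓ₁ ℓ₂ ℓ₃ : Level) : Set (lsuc (c ⊔ ℓ₁ ⊔ ℓ₂ ⊔ ℓ₃)) where
  infix 4 _<_ _≤_
  field
    heytingField : HeytingField c ℓ₁ ℓ₂

  open HeytingField heytingField public

  field
    _<_                  : Rel Carrier ℓ₃
    isStrictPartialOrder : IsStrictPartialOrder _≈_ _<_
    #⇒<⊎>                : ∀ {x y} → x # y → x < y ⊎ y < x
    <⇒#                  : ∀ {x y} → x < y → x # y
    +-monoˡ-<            : ∀ {x y} w → x < y → x + w < y + w
    *-pos                : ∀ {x y} → 0# < x → 0# < y → 0# < x * y

  _≤_ : Rel Carrier ℓ₃
  x ≤ y = ¬ (y < x)

  commutativeRing : CommutativeRing c ℓ₁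
  commutativeRing = record { isCommutativeRing = isCommutativeRing }

module Geometry {c ℓ₁ ℓ₂ ℓ₃} (𝔽 : OrderedField c ℓ₁ ℓ₂ ℓ₃) where

  open OrderedField 𝔽 using (Carrier; _≈_; _≤_; _+_; _*_; 0#; 1#; commutativeRing)
  open import Algebra.Properties.CommutativeMonoid.Sum
    (CommutativeRing.+-commutativeMonoid commutativeRing) using (sum)

  Point : Set → Set c
  Point X = X → Carrier

  infix 4 _≋_
  _≋_ : {X : Set} → Rel (Point X) ℓ₁
  x ≋ y = ∀ a → x a ≈ y a

  record Conv {X S : Set} (p : S → Point X) (x : Point X) : Set (c ⊔ ℓ₁ ⊔ ℓ₃) where
    field
      size        : ℕ
      weight      : Fin size → Carrier
      pick        : Fin size → S
      nonneg      : ∀ t → 0# ≤ weight t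
      total       : sum weight ≈ 1#
      combination : x ≋ λ a → sum λ t → weight t * p (pick t) a

  record Halfspace (d : ℕ) : Set c where
    field
      normal : Fin d → Carrier
      bound  : Carrier

    evaluate : Point (Fin d) → Carrier
    evaluate y = sum λ a → normal a * y a

  open Halfspace

  module _ {d : ℕ} {ℓ} (Q : Pred (Point (Fin d)) ℓ) where

    Face : Halfspace d → Pred (Point (Fin d)) (ℓ₁ ⊔ ℓ)
    Face h y = Q y × evaluate h y ≈ bound h

    IsProperFace : Halfspace d → Set (c ⊔ ℓ₁ ⊔ ℓ₃ ⊔ ℓ)
    IsProperFace h = (∀ y → Q y → evaluate h y ≤ bound h) × ¬ (Q ⊆ Face h)

    -- Facets are the inclusion-maximal proper faces.
    IsFacet : Halfspace d → Set (c ⊔ ℓ₁ ⊔ ℓ₃ ⊔ ℓ)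
    IsFacet h = IsProperFace h × (∀ g → IsProperFace g → Face h ⊆ Face g → Face g ⊆ Face h)

    -- Many halfspaces define the same facet, so facets are counted as sets of
    -- points.
    record HasFacets (k : ℕ) : Set (c ⊔ ℓ₁ ⊔ ℓ₃ ⊔ ℓ) where
      field
        facet      : Fin k → Halfspace d
        isFacet    : ∀ i → IsFacet (facet i)
        distinct   : ∀ i j → Face (facet i) ≐ Face (facet j) → i ≡ j
        exhaustive : ∀ h → IsFacet h → ∃[ i ] Face h ≐ Face (facet i)

  -- A polytope with k facets together with an affine map onto P.  The extension
  -- complexity xc(P) is the least k for which one exists: xc(P) ≥ m says that
  -- m ≤ k whenever Extension P k, and xc(P) ≤ m that Extension P k for some
  -- k ≤ m.
  record Extension {X : Set} {ℓ} (P : Pred (Point X) ℓ) (k : ℕ) : Set (c ⊔ ℓ₁ ⊔ ℓ₃ ⊔ ℓ) where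
    field
      dimension #vertices : ℕ
      vertices            : Fin #vertices → Point (Fin dimension)
      hasFacets           : HasFacets (Conv vertices) k
      matrix              : X → Fin dimension → Carrier
      offset              : X → Carrier

    image : Point (Fin dimension) → Point X
    image y a = sum (λ b → matrix a b * y b) + offset a

    field
      into : ∀ y → Conv vertices y → P (image y)
      onto : ∀ x → P x → ∃[ y ] Conv vertices y × x ≋ image y

  indicator : Bool → Carrier
  indicator b = if b then 1# else 0#

  δ : {V : Set} → (V → Bool) → Point (Pair V)
  δ S (pair v w _) = indicator (S v xor S w)

  CUT : (V : Set) → Pred (Point (Pair V)) (c ⊔ ℓ₁ ⊔ ℓ₃)
  CUT V = Conv (δ {V})

  -- A point of CUT V has a coordinate for every pair of vertices, but marginals
  -- of relation events only determine those of pairs in a common hyperedge.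
  restrict : (G : Hypergraph₃) → Point (Pair (Hypergraph₃.V G)) → Point (CoveredPair G)
  restrict G x = x ∘ coveredPair G

  ProperCutFace : (G : Hypergraph₃) → Pred (Point (Pair (Hypergraph₃.V G))) (c ⊔ ℓ₁ ⊔ ℓ₃)
  ProperCutFace G x = CUT V x × (∀ e →
      x (coveredPair G (e , pair zero       (suc zero)       λ ()))
    + x (coveredPair G (e , pair zero       (suc (suc zero)) λ ()))
    + x (coveredPair G (e , pair (suc zero) (suc (suc zero)) λ ()))
    ≈ 1# + 1#)
    where open Hypergraph₃ G

  marginalVector : {𝕋 : Template} {I : Instance 𝕋} {W : Instance.Var I → Bool} →
                   Hom I → Point (Event I W)
  marginalVector {I = I} h (relationEvent e b) = indicator (does
    (Vec.≡-dec Bool._≟_ (Vec.map (Hom.value h) (Instance.scope I e)) (Tuple.entries b)))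
  marginalVector h (singletonEvent v _ a) = indicator (does (Hom.value h v Bool.≟ a))

  Marginal : {𝕋 : Template} (I : Instance 𝕋) (W : Instance.Var I → Bool) →
             Pred (Point (Event I W)) (c ⊔ ℓ₁ ⊔ ℓ₃)
  Marginal I W = Conv (marginalVector {I = I} {W = W})

  module _ (ϑ : ℚ) (G : Hypergraph₃) where

    SwitchEvent : Set
    SwitchEvent = Event (switchInstance ϑ G) isGate

    𝓜sw : Pred (Point SwitchEvent) (c ⊔ ℓ₁ ⊔ ℓ₃)
    𝓜sw = Marginal (switchInstance ϑ G) isGate

    OpenGateFace : Pred (Point SwitchEvent) (c ⊔ ℓ₁ ⊔ ℓ₃)
    OpenGateFace y = 𝓜sw y
      × y (singletonEvent gate-r _ false) ≈ 1#
      × y (singletonEvent gate-z _ true)  ≈ 1#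

    -- The linear map that reads off, for each covered pair, the marginal of the
    -- event that its two vertices receive different values.  In a scope the
    -- vertices come after the two gates, hence the shift by 2.
    project : Point SwitchEvent → Point (CoveredPair G)
    project y (e , pair k l _) = List.foldr _+_ 0# (List.map
      (λ b → indicator (Vec.lookup (Tuple.entries b) (2 ↑ʳ k) xor Vec.lookup (Tuple.entries b) (2 ↑ʳ l))
             * y (relationEvent e b))
      (tuples (switchTemplate ϑ)))

module Submission where

-- A Boolean assignment with equal gates satisfies every switch constraint, so
-- the vertices of the marginal polytope include one for every subset of U.  The
-- squares (1 - |a ∩ b|)² are affine in the relation events and give a slack
-- matrix whose support, by Kaibel and Weltge, needs at least (3/2)^(n-1)
-- rectangles.  The facets of an extension form such a covering, because every
-- face of a polytope is the intersection of the facets containing it.  For the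
-- projection, a weight in a convex combination vanishes wherever a bounded
-- functional misses the maximum that the combination attains.

open import Defs
open import Algebra.Bundles using (CommutativeRing)
open import Data.Bool using (Bool; true; false; _∧_; _xor_; T)
open import Data.Bool.Properties using (T?; T-∧)
import Data.Bool.Properties as Bool
open import Data.Fin as Fin using (Fin; zero; suc; _↑ʳ_)
import Data.Fin.Properties as Fin
open import Data.List as List using (List; []; _∷_)
open import Data.List.Membership.Propositional.Properties using (∈-allFin)
open import Data.List.Relation.Unary.All as All using (All; []; _∷_)
open import Data.Nat as ℕ using (ℕ)
open import Data.Nat.ListAction using () renaming (sum to sumℕ)
import Data.Nat.Properties as ℕ
open import Data.Product using (∃-syntax; _×_; _,_; proj₁; proj₂)
open import Data.Rational using (ℚ; 0ℚ; 1ℚ) renaming (_<_ to _<ℚ_)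
open import Data.Sum using (_⊎_; inj₁; inj₂; [_,_]′)
open import Data.Unit using (tt)
open import Data.Vec as Vec using (Vec; []; _∷_)
import Data.Vec.Properties as Vec
open import Function using (_∘_)
open import Function.Bundles using (Equivalence; Inverse; _↔_)
open import Level using (Level)
open import Relation.Binary.Definitions using (tri<; tri≈; tri>)
open import Relation.Binary.PropositionalEquality as ≡ using (_≡_)
open import Relation.Binary.Structures using (IsStrictPartialOrder)
open import Relation.Nullary using (¬_; contradiction; Dec; yes; no; does)
open import Relation.Nullary.Decidable
  using (¬¬-excluded-middle; decidable-stable; _→-dec_; _×-dec_; from-yes; fromWitness; toWitness; isYes; map′)
open import Relation.Unary using (_⊆_)

-- The order of an `OrderedField` is not decidable: trichotomy is available only under double
-- negation, whereas `≈` and `≤` are stable. This shapes the polytope theory. Minimising a ratio,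
-- enlarging a face to a facet and deciding which rectangle contains which pair all happen under
-- double negation. They can be escaped from because the outcome is an inequality between natural
-- numbers, which is decidable. Facets are defined as maximal proper faces, so a facet through a
-- given face that misses a given point has to be produced: a valid inequality that is loose at the
-- point is changed until its set of tight vertices is maximal, and maximality is shown to force a
-- facet. The squares read relation events alone, so the lower bound holds for every selection `W`
-- of singleton coordinates, as the last clause of the theorem demands. One vertex of U is spent on
-- providing a hyperedge through each of the others, whence the exponent n - 1.

module UniqueDisjointness where

  open import Algebra.Properties.Semiring.Sum ℕ.+-*-semiring using () renaming (sum to ∑ℕ)
  open import Data.Bool using (_∨_; if_then_else_)
  open import Data.Nat using (zero; suc; _+_; _*_; _^_; _≤_; z≤n; s≤s)
  open import Data.Nat.Properties
  open import Data.Nat.Tactic.RingSolver using (solve-∀)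
  open import Relation.Binary.PropositionalEquality using (refl; sym; trans; cong)

  -- Rectangle coverings of the pairs of disjoint sets.

  ⟦_⟧ : Bool → ℕ
  ⟦ b ⟧ = if b then 1 else 0

  ∣_∩_∣ : ∀ {n} → Vec Bool n → Vec Bool n → ℕ
  ∣ [] ∩ [] ∣         = 0
  ∣ x ∷ a ∩ y ∷ b ∣ = ⟦ x ∧ y ⟧ + ∣ a ∩ b ∣

  -- The branch in which both heads are `true` is left out, so the recursion visits exactly the 3 ^
  -- n disjoint pairs.
  sumDisjoint : ∀ n → (Vec Bool n → Vec Bool n → ℕ) → ℕ
  sumDisjoint zero    f = f [] []
  sumDisjoint (suc n) f = sumDisjoint n (λ a b → f (false ∷ a) (false ∷ b))
                        + (sumDisjoint n (λ a b → f (true ∷ a) (false ∷ b))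
                        + sumDisjoint n (λ a b → f (false ∷ a) (true ∷ b)))

  -- The comparison is asked at disjoint pairs only, because its uses `fibre` and `covered` have it
  -- only there.
  sumDisjoint-mono : ∀ n {f g} → (∀ a b → ∣ a ∩ b ∣ ≡ 0 → f a b ≤ g a b) → sumDisjoint n f ≤ sumDisjoint n g
  sumDisjoint-mono zero    le = le [] [] refl
  sumDisjoint-mono (suc n) le = +-mono-≤ (sumDisjoint-mono n (λ a b → le (false ∷ a) (false ∷ b)))
    (+-mono-≤ (sumDisjoint-mono n (λ a b → le (true ∷ a) (false ∷ b)))
              (sumDisjoint-mono n (λ a b → le (false ∷ a) (true ∷ b))))

  private
    interchange₃ : ∀ a b c d e f → a + d + (b + e + (c + f)) ≡ a + (b + c) + (d + (e + f))
    interchange₃ = solve-∀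

  sumDisjoint-+ : ∀ n f g → sumDisjoint n (λ a b → f a b + g a b) ≡ sumDisjoint n f + sumDisjoint n g
  sumDisjoint-+ zero    f g = refl
  sumDisjoint-+ (suc n) f g
    rewrite sumDisjoint-+ n (λ a b → f (false ∷ a) (false ∷ b)) (λ a b → g (false ∷ a) (false ∷ b))
          | sumDisjoint-+ n (λ a b → f (true ∷ a) (false ∷ b)) (λ a b → g (true ∷ a) (false ∷ b))
          | sumDisjoint-+ n (λ a b → f (false ∷ a) (true ∷ b)) (λ a b → g (false ∷ a) (true ∷ b))
    = interchange₃
        (sumDisjoint n (λ a b → f (false ∷ a) (false ∷ b)))
        (sumDisjoint n (λ a b → f (true ∷ a) (false ∷ b)))
        (sumDisjoint n (λ a b → f (false ∷ a) (true ∷ b)))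
        (sumDisjoint n (λ a b → g (false ∷ a) (false ∷ b)))
        (sumDisjoint n (λ a b → g (true ∷ a) (false ∷ b)))
        (sumDisjoint n (λ a b → g (false ∷ a) (true ∷ b)))

  sumDisjoint-const : ∀ n c → sumDisjoint n (λ _ _ → c) ≡ 3 ^ n * c
  sumDisjoint-const zero    c = sym (+-identityʳ c)
  sumDisjoint-const (suc n) c rewrite sumDisjoint-const n c = triple (3 ^ n) c
    where
    triple : ∀ t c → t * c + (t * c + t * c) ≡ 3 * t * c
    triple = solve-∀

  sumDisjoint-∑ : ∀ n k (f : Fin k → Vec Bool n → Vec Bool n → ℕ) →
                  sumDisjoint n (λ a b → ∑ℕ (λ i → f i a b)) ≡ ∑ℕ (λ i → sumDisjoint n (f i))
  sumDisjoint-∑ n zero    f = trans (sumDisjoint-const n 0) (*-zeroʳ (3 ^ n))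
  sumDisjoint-∑ n (suc k) f = trans (sumDisjoint-+ n _ _) (cong (sumDisjoint n (f zero) +_) (sumDisjoint-∑ n k (λ i → f (suc i))))

  -- Each disjoint pair (a , b) has three extensions by one element, (0a , 0b),
  -- (1a , 0b) and (0a , 1b).  At most two of them lie in A × B, because with the
  -- last two also (1a , 1b) would, which meets in exactly one element.  Hence the
  -- extensions are counted by two rectangles of the lower dimension.
  rectangle-bound : ∀ n (A B : Vec Bool n → Bool) →
                    (∀ a b → T (A a) → T (B b) → ¬ ∣ a ∩ b ∣ ≡ 1) →
                    sumDisjoint n (λ a b → ⟦ A a ∧ B b ⟧) ≤ 2 ^ n
  rectangle-bound zero    A B _ with A [] ∧ B []
  ... | true  = s≤s z≤n
  ... | false = z≤n
  rectangle-bound (suc n) A B avoids = begin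
      s₀₀ + (s₁₀ + s₀₁)
        ≡⟨ cong (s₀₀ +_) (sumDisjoint-+ n _ _) ⟨
      s₀₀ + sumDisjoint n (λ a b → ⟦ A₁ a ∧ B₀ b ⟧ + ⟦ A₀ a ∧ B₁ b ⟧)
        ≡⟨ sumDisjoint-+ n _ _ ⟨
      sumDisjoint n (λ a b → ⟦ A₀ a ∧ B₀ b ⟧ + (⟦ A₁ a ∧ B₀ b ⟧ + ⟦ A₀ a ∧ B₁ b ⟧))
        ≤⟨ sumDisjoint-mono n fibre ⟩
      sumDisjoint n (λ a b → ⟦ (A₀ a ∨ A₁ a) ∧ B₀ b ⟧ + ⟦ A₀ a ∧ (B₀ b ∨ B₁ b) ⟧)
        ≡⟨ sumDisjoint-+ n _ _ ⟩
      sumDisjoint n (λ a b → ⟦ (A₀ a ∨ A₁ a) ∧ B₀ b ⟧) + sumDisjoint n (λ a b → ⟦ A₀ a ∧ (B₀ b ∨ B₁ b) ⟧)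
        ≤⟨ +-mono-≤ (rectangle-bound n (λ a → A₀ a ∨ A₁ a) B₀ avoidsˡ)
                    (rectangle-bound n A₀ (λ b → B₀ b ∨ B₁ b) avoidsʳ) ⟩
      2 ^ n + 2 ^ n
        ≡⟨ cong (2 ^ n +_) (+-identityʳ (2 ^ n)) ⟨
      2 ^ suc n ∎
    where
    open ≤-Reasoning
    A₀ A₁ B₀ B₁ : Vec Bool n → Bool
    A₀ a = A (false ∷ a)
    A₁ a = A (true ∷ a)
    B₀ b = B (false ∷ b)
    B₁ b = B (true ∷ b)
    s₀₀ s₁₀ s₀₁ : ℕ
    s₀₀ = sumDisjoint n (λ a b → ⟦ A₀ a ∧ B₀ b ⟧)
    s₁₀ = sumDisjoint n (λ a b → ⟦ A₁ a ∧ B₀ b ⟧)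
    s₀₁ = sumDisjoint n (λ a b → ⟦ A₀ a ∧ B₁ b ⟧)

    T-∨ : ∀ x y {p} {P : Set p} → (T x → P) → (T y → P) → T (x ∨ y) → P
    T-∨ true  y l r t = l t
    T-∨ false y l r t = r t

    avoidsˡ : ∀ a b → T (A₀ a ∨ A₁ a) → T (B₀ b) → ¬ ∣ a ∩ b ∣ ≡ 1
    avoidsˡ a b ta tb = T-∨ (A₀ a) (A₁ a) (λ t → avoids (false ∷ a) (false ∷ b) t tb)
                                          (λ t → avoids (true ∷ a) (false ∷ b) t tb) ta

    avoidsʳ : ∀ a b → T (A₀ a) → T (B₀ b ∨ B₁ b) → ¬ ∣ a ∩ b ∣ ≡ 1
    avoidsʳ a b ta = T-∨ (B₀ b) (B₁ b) (avoids (false ∷ a) (false ∷ b) ta) (avoids (false ∷ a) (true ∷ b) ta)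

    bools : ∀ a₀ a₁ b₀ b₁ → ¬ (T a₁ × T b₁) →
            ⟦ a₀ ∧ b₀ ⟧ + (⟦ a₁ ∧ b₀ ⟧ + ⟦ a₀ ∧ b₁ ⟧) ≤ ⟦ (a₀ ∨ a₁) ∧ b₀ ⟧ + ⟦ a₀ ∧ (b₀ ∨ b₁) ⟧
    bools a₀    true  b₀    true  ¬both = contradiction (tt , tt) ¬both
    bools false false b₀    b₁    _ = ≤-refl
    bools false true  true  false _ = ≤-refl
    bools false true  false false _ = ≤-refl
    bools true  false false b₁    _ = ≤-refl
    bools true  false true  true  _ = ≤-refl
    bools true  false true  false _ = s≤s z≤n
    bools true  true  true  false _ = ≤-refl
    bools true  true  false false _ = ≤-refl

    fibre : ∀ a b → ∣ a ∩ b ∣ ≡ 0 →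
            ⟦ A₀ a ∧ B₀ b ⟧ + (⟦ A₁ a ∧ B₀ b ⟧ + ⟦ A₀ a ∧ B₁ b ⟧) ≤ ⟦ (A₀ a ∨ A₁ a) ∧ B₀ b ⟧ + ⟦ A₀ a ∧ (B₀ b ∨ B₁ b) ⟧
    fibre a b disj = bools (A₀ a) (A₁ a) (B₀ b) (B₁ b)
      (λ (ta , tb) → avoids (true ∷ a) (true ∷ b) ta tb (cong suc disj))

  ∑ℕ-bound : ∀ k (f : Fin k → ℕ) c → (∀ i → f i ≤ c) → ∑ℕ f ≤ k * c
  ∑ℕ-bound zero    f c le = z≤n
  ∑ℕ-bound (suc k) f c le = +-mono-≤ (le zero) (∑ℕ-bound k (λ i → f (suc i)) c (λ i → le (suc i)))

  ∑ℕ-positive : ∀ {k} (f : Fin k → ℕ) i → 1 ≤ f i → 1 ≤ ∑ℕ f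
  ∑ℕ-positive f zero    le = ≤-trans le (m≤m+n (f zero) _)
  ∑ℕ-positive f (suc i) le = ≤-trans (∑ℕ-positive (λ j → f (suc j)) i le) (m≤n+m _ (f zero))

  -- Double counting: each of the 3 ^ n disjoint pairs is covered at least once, and a rectangle
  -- that avoids the pairs meeting once covers at most 2 ^ n of them.
  rectangle-cover-bound : ∀ n k (A B : Fin k → Vec Bool n → Bool) →
    (∀ i a b → T (A i a) → T (B i b) → ¬ ∣ a ∩ b ∣ ≡ 1) →
    (∀ a b → ∣ a ∩ b ∣ ≡ 0 → ∃[ i ] T (A i a ∧ B i b)) →
    3 ^ n ≤ k * 2 ^ n
  rectangle-cover-bound n k A B avoids covers = begin
      3 ^ n                                                    ≡⟨ *-identityʳ (3 ^ n) ⟨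
      3 ^ n * 1                                                ≡⟨ sumDisjoint-const n 1 ⟨
      sumDisjoint n (λ _ _ → 1)                                ≤⟨ sumDisjoint-mono n covered ⟩
      sumDisjoint n (λ a b → ∑ℕ (λ i → ⟦ A i a ∧ B i b ⟧))     ≡⟨ sumDisjoint-∑ n k _ ⟩
      ∑ℕ (λ i → sumDisjoint n (λ a b → ⟦ A i a ∧ B i b ⟧))     ≤⟨ ∑ℕ-bound k _ (2 ^ n) (λ i → rectangle-bound n (A i) (B i) (avoids i)) ⟩
      k * 2 ^ n                                                ∎
    where
    open ≤-Reasoning
    positive : ∀ x → T x → 1 ≤ ⟦ x ⟧
    positive true _ = ≤-refl
    covered : ∀ a b → ∣ a ∩ b ∣ ≡ 0 → 1 ≤ ∑ℕ (λ i → ⟦ A i a ∧ B i b ⟧)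
    covered a b disj with i , t ← covers a b disj = ∑ℕ-positive _ i (positive _ t)

  -- Squaring the hypothesis gives 9 ^ n ≤ k² 4 ^ n, and 8 ^ n ≤ 9 ^ n leaves 2 ^ n ≤ k². A second
  -- squaring pays for the exponent `suc n`, since n + 1 ≤ 2 n for n ≥ 1; this is the origin of the
  -- exponent 4.
  2^-bound : ∀ n k → 1 ≤ n → 3 ^ n ≤ k * 2 ^ n → 2 ^ suc n ≤ k ^ 4
  2^-bound n k 1≤n le = begin
      2 ^ suc n           ≤⟨ ^-monoʳ-≤ 2 (≤-trans (+-monoˡ-≤ n 1≤n) (≤-reflexive (cong (n +_) (sym (+-identityʳ n))))) ⟩
      2 ^ (2 * n)         ≡⟨ cong (2 ^_) (*-comm 2 n) ⟩
      2 ^ (n * 2)         ≡⟨ ^-*-assoc 2 n 2 ⟨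
      (2 ^ n) ^ 2         ≤⟨ ^-monoˡ-≤ 2 2^n≤k² ⟩
      (k ^ 2) ^ 2         ≡⟨ ^-*-assoc k 2 2 ⟩
      k ^ 4               ∎
    where
    open ≤-Reasoning
    square : ∀ x y → (x * y) * ((x * y) * 1) ≡ (x * (x * 1)) * (y * (y * 1))
    square = solve-∀
    8^n≤ : 2 ^ n * (2 ^ n) ^ 2 ≤ k ^ 2 * (2 ^ n) ^ 2
    8^n≤ = begin
      2 ^ n * (2 ^ n) ^ 2   ≡⟨ cong (2 ^ n *_) (^-*-assoc 2 n 2) ⟩
      2 ^ n * 2 ^ (n * 2)   ≡⟨ ^-distribˡ-+-* 2 n (n * 2) ⟨
      2 ^ (n + n * 2)       ≡⟨ cong (2 ^_) (trans (sym (*-suc n 2)) (*-comm n 3)) ⟩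
      2 ^ (3 * n)           ≡⟨ ^-*-assoc 2 3 n ⟨
      8 ^ n                 ≤⟨ ^-monoˡ-≤ n (n≤1+n 8) ⟩
      9 ^ n                 ≡⟨ ^-*-assoc 3 2 n ⟩
      3 ^ (2 * n)           ≡⟨ cong (3 ^_) (*-comm 2 n) ⟩
      3 ^ (n * 2)           ≡⟨ ^-*-assoc 3 n 2 ⟨
      (3 ^ n) ^ 2           ≤⟨ ^-monoˡ-≤ 2 le ⟩
      (k * 2 ^ n) ^ 2       ≡⟨ square k (2 ^ n) ⟩
      k ^ 2 * (2 ^ n) ^ 2   ∎
    instance
      nz : _
      nz = m^n≢0 (2 ^ n) 2 ⦃ m^n≢0 2 n ⦄
    2^n≤k² : 2 ^ n ≤ k ^ 2
    2^n≤k² = *-cancelʳ-≤ (2 ^ n) (k ^ 2) ((2 ^ n) ^ 2) 8^n≤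

open UniqueDisjointness

-- The size of the instance, and growth of exponentials.

module Counting where

  open import Data.Empty.Irrelevant using (⊥-elim)
  open import Data.Fin.Properties using (+↔⊎)
  open import Data.Nat using (zero; suc; _+_; _*_; _^_; _≤_; _<_; z≤n; s≤s; s<s⁻¹)
  open import Data.Nat.Properties
  open import Data.Nat.Tactic.RingSolver using (solve-∀)
  open import Data.Sum.Function.Propositional using (_⊎-↔_)
  open import Function.Bundles using (mk↔ₛ′)
  open import Function.Construct.Composition using (_↔-∘_)
  open import Function.Construct.Identity using (↔-id)
  open import Function.Construct.Symmetry using (↔-sym)
  open import Relation.Binary.PropositionalEquality using (refl; sym; trans; cong)

  #pairs : ℕ → ℕ
  #pairs zero    = 0
  #pairs (suc n) = n + #pairs n

  #vertices : ℕ → ℕ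
  #vertices n = n + #pairs n

  -- A pair either contains 0, and is then named by the predecessor of its larger element, or is a
  -- shifted pair of the smaller range. The recursion of `#pairs` follows this split.
  Pair<-suc : ∀ n → Pair< (suc n) ↔ (Fin n ⊎ Pair< n)
  Pair<-suc n = mk↔ₛ′ to from to∘from from∘to
    where
    to : Pair< (suc n) → Fin n ⊎ Pair< n
    to (pair< i       zero    i<j) = ⊥-elim (n≮0 i<j)
    to (pair< zero    (suc j) _)   = inj₁ j
    to (pair< (suc i) (suc j) i<j) = inj₂ (pair< i j (s<s⁻¹ i<j))
    from : Fin n ⊎ Pair< n → Pair< (suc n)
    from (inj₁ j)               = pair< zero (suc j) (s≤s z≤n)
    from (inj₂ (pair< i j i<j)) = pair< (suc i) (suc j) (s≤s i<j)
    to∘from : ∀ x → to (from x) ≡ x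
    to∘from (inj₁ j)              = refl
    to∘from (inj₂ (pair< i j i<j)) = refl
    from∘to : ∀ e → from (to e) ≡ e
    from∘to (pair< i       zero    i<j) = ⊥-elim (n≮0 i<j)
    from∘to (pair< zero    (suc j) i<j) = refl
    from∘to (pair< (suc i) (suc j) i<j) = refl

  Pair<↔Fin : ∀ n → Pair< n ↔ Fin (#pairs n)
  Pair<↔Fin zero    = mk↔ₛ′ (λ where (pair< () _ _)) (λ ()) (λ ()) (λ where (pair< () _ _))
  Pair<↔Fin (suc n) = ↔-sym +↔⊎ ↔-∘ ((↔-id _ ⊎-↔ Pair<↔Fin n) ↔-∘ Pair<-suc n)

  Vertex↔Fin : ∀ n → Vertex n ↔ Fin (#vertices n)
  Vertex↔Fin n = ↔-sym +↔⊎ ↔-∘ ((↔-id _ ⊎-↔ Pair<↔Fin n) ↔-∘ split)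
    where
    split : Vertex n ↔ (Fin n ⊎ Pair< n)
    split = mk↔ₛ′ (λ where (u i) → inj₁ i
                           (z e) → inj₂ e)
                  (λ where (inj₁ i) → u i
                           (inj₂ e) → z e)
                  (λ where (inj₁ _) → refl
                           (inj₂ _) → refl)
                  (λ where (u _) → refl
                           (z _) → refl)

  SwitchVar↔Fin : ∀ {V m} → V ↔ Fin m → SwitchVar V ↔ Fin (2 + m)
  SwitchVar↔Fin {V} {m} V↔ = ↔-sym +↔⊎ ↔-∘ ((↔-id _ ⊎-↔ V↔) ↔-∘ split)
    where
    split : SwitchVar V ↔ (Fin 2 ⊎ V)
    split = mk↔ₛ′ (λ where gate-r        → inj₁ zero
                           gate-z        → inj₁ (suc zero)
                           (vertexVar v) → inj₂ v)
                  (λ where (inj₁ zero)       → gate-r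
                           (inj₁ (suc zero)) → gate-z
                           (inj₂ v)          → vertexVar v)
                  (λ where (inj₁ zero)       → refl
                           (inj₁ (suc zero)) → refl
                           (inj₂ _)          → refl)
                  (λ where gate-r        → refl
                           gate-z        → refl
                           (vertexVar _) → refl)

  -- Both sides count ordered pairs: n lie on the diagonal, and every unordered pair occurs twice.
  #vertices+#pairs : ∀ n → #vertices n + #pairs n ≡ n * n
  #vertices+#pairs zero    = refl
  #vertices+#pairs (suc n) = trans (shape n (#pairs n)) (trans (cong (λ t → suc n + (n + t)) (#vertices+#pairs n)) (square n))
    where
    shape : ∀ n t → suc n + (n + t) + (n + t) ≡ suc n + (n + (n + t + t))
    shape = solve-∀
    square : ∀ n → suc n + (n + n * n) ≡ suc n * suc n
    square = solve-∀

  #vertices≤n*n : ∀ n → #vertices n ≤ n * n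
  #vertices≤n*n n = ≤-trans (m≤m+n _ (#pairs n)) (≤-reflexive (#vertices+#pairs n))

  #vertices-Θ : IsΘ #vertices (λ n → n * n)
  #vertices-Θ = 2 , 0 , λ n _ →
      ≤-trans (#vertices≤n*n n) (m≤m+n (n * n) _)
    , ≤-trans (≤-reflexive (sym (#vertices+#pairs n)))
              (+-monoʳ-≤ (#vertices n) (≤-trans (m≤n+m (#pairs n) n) (m≤m+n (#vertices n) 0)))

  -- From p² ≤ q² m ≤ (n q)² follows p ≤ n q, so the root is never formed.
  2^√-bound : ∀ n {m} k → m ≤ n * n → 2 ^ n ≤ k → 2^√ m ≤ k
  2^√-bound n {m} k m≤n² 2^n≤k p q p²≤q²m = begin
      2 ^ p         ≤⟨ ^-monoʳ-≤ 2 p≤n*q ⟩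
      2 ^ (n * q)   ≡⟨ ^-*-assoc 2 n q ⟨
      (2 ^ n) ^ q   ≤⟨ ^-monoˡ-≤ q 2^n≤k ⟩
      k ^ q         ∎
    where
    open ≤-Reasoning
    squares : ∀ n q → q * q * (n * n) ≡ (n * q) * (n * q)
    squares = solve-∀
    p≤n*q : p ≤ n * q
    p≤n*q = ≮⇒≥ λ nq<p → <⇒≱ (*-mono-< nq<p nq<p)
      (≤-trans p²≤q²m (≤-trans (*-monoʳ-≤ (q * q) m≤n²) (≤-reflexive (squares n q))))

  n<2^n : ∀ n → n < 2 ^ n
  n<2^n zero    = s≤s z≤n
  n<2^n (suc n) = ≤-trans (+-mono-≤ (m^n>0 2 n) (n<2^n n)) (+-monoʳ-≤ (2 ^ n) (m≤m+n (2 ^ n) 0))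

  -- The number of variables and constraints of the instance of H n is at most
  -- 8 n².  For n = 2 ^ t a bound C (8 n²) ^ d is at most 2 ^ (C + d (3 + 2 t)),
  -- whose exponent is linear in t.
  exponential-beats-polynomial : ∀ C d e → ∃[ n ] 2 ≤ n ×
    (C * suc (2 + #vertices n + #pairs n) ^ d) ^ e < 2 ^ n
  exponential-beats-polynomial C d e = n , 2≤n , <-≤-trans bound (^-monoʳ-≤ 2 exponent)
    where
    open ≤-Reasoning
    K t n : ℕ
    -- `K` dominates both the constant term and the slope of the exponent. With t = 1 + 2 K, one
    -- more than K + K t is at most 2 (K + 1)², hence at most 2 · 2 ^ K · 2 ^ K = 2 ^ t = n.
    K = (C + d * 3 + d * 2) * e
    t = 1 + K + K
    n = 2 ^ t
    2≤n : 2 ≤ n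
    2≤n = ^-monoʳ-≤ 2 {1} {t} (s≤s z≤n)
    size : suc (2 + #vertices n + #pairs n) ≤ 2 ^ (3 + t * 2)
    size = begin
      3 + (#vertices n + #pairs n)   ≡⟨ cong (3 +_) (#vertices+#pairs n) ⟩
      3 + n * n                      ≤⟨ +-monoˡ-≤ (n * n) (*-monoʳ-≤ 3 (*-mono-≤ 1≤n 1≤n)) ⟩
      3 * (n * n) + n * n            ≤⟨ +-monoʳ-≤ (3 * (n * n)) (m≤m+n (n * n) (4 * (n * n))) ⟩
      3 * (n * n) + 5 * (n * n)      ≡⟨ *-distribʳ-+ (n * n) 3 5 ⟨
      8 * (n * n)                    ≡⟨ cong (λ x → 8 * (n * x)) (*-identityʳ n) ⟨
      8 * n ^ 2                      ≡⟨ cong (8 *_) (^-*-assoc 2 t 2) ⟩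
      8 * 2 ^ (t * 2)                ≡⟨ ^-distribˡ-+-* 2 3 (t * 2) ⟨
      2 ^ (3 + t * 2)                ∎
      where
      1≤n : 1 ≤ n
      1≤n = m^n>0 2 t
    bound : (C * suc (2 + #vertices n + #pairs n) ^ d) ^ e < 2 ^ suc ((C + (3 + t * 2) * d) * e)
    bound = ≤-<-trans (begin
        (C * suc (2 + #vertices n + #pairs n) ^ d) ^ e
          ≤⟨ ^-monoˡ-≤ e (*-mono-≤ (<⇒≤ (n<2^n C)) (^-monoˡ-≤ d size)) ⟩
        (2 ^ C * (2 ^ (3 + t * 2)) ^ d) ^ e
          ≡⟨ cong (λ x → (2 ^ C * x) ^ e) (^-*-assoc 2 (3 + t * 2) d) ⟩
        (2 ^ C * 2 ^ ((3 + t * 2) * d)) ^ e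
          ≡⟨ cong (_^ e) (^-distribˡ-+-* 2 C _) ⟨
        (2 ^ (C + (3 + t * 2) * d)) ^ e
          ≡⟨ ^-*-assoc 2 (C + (3 + t * 2) * d) e ⟩
        2 ^ ((C + (3 + t * 2) * d) * e) ∎)
      (^-monoʳ-< 2 (s≤s (s≤s z≤n)) (n<1+n ((C + (3 + t * 2) * d) * e)))
    linear : ∀ C d e t → (C + (3 + t * 2) * d) * e + (C * e * t + d * 3 * e * t) ≡ (C + d * 3) * e + ((C + d * 3 + d * 2) * e) * t
    linear = solve-∀
    K≤ : (C + d * 3) * e ≤ K
    K≤ = *-monoˡ-≤ e (m≤m+n (C + d * 3) (d * 2))
    quadratic : ∀ K → suc (K + K * (1 + K + K)) + (1 + (2 * K + 0)) ≡ 2 * (suc K * suc K)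
    quadratic = solve-∀
    exponent : suc ((C + (3 + t * 2) * d) * e) ≤ n
    exponent = begin
      suc ((C + (3 + t * 2) * d) * e)           ≤⟨ s≤s (m≤m+n _ _) ⟩
      suc ((C + (3 + t * 2) * d) * e + (C * e * t + d * 3 * e * t))
                                                ≡⟨ cong suc (linear C d e t) ⟩
      suc ((C + d * 3) * e + K * t)             ≤⟨ s≤s (+-monoˡ-≤ (K * t) K≤) ⟩
      suc (K + K * t)                           ≤⟨ m≤m+n _ _ ⟩
      suc (K + K * t) + (1 + (2 * K + 0))             ≡⟨ quadratic K ⟩
      2 * (suc K * suc K)                       ≤⟨ *-monoʳ-≤ 2 (*-mono-≤ (n<2^n K) (n<2^n K)) ⟩
      2 * (2 ^ K * 2 ^ K)                       ≡⟨ cong (2 *_) (^-distribˡ-+-* 2 K K) ⟨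
      2 ^ t                                     ∎

open Counting

-- Order arithmetic without a decidable order.

module OrderedFieldProperties {c ℓ₁ ℓ₂ ℓ₃} (𝔽 : OrderedField c ℓ₁ ℓ₂ ℓ₃) where

  open OrderedField 𝔽 public using (_<_; _≤_)
  open OrderedField 𝔽 using (isStrictPartialOrder; #⇒<⊎>; +-monoˡ-<; *-pos; tight; invertible⇒#; commutativeRing)
  open CommutativeRing commutativeRing public hiding (zero)
  open import Algebra.Properties.Semiring.Sum semiring public
    using (sum; sum-cong-≋; ∑-distrib-+; ∑-comm; *-distribˡ-sum; *-distribʳ-sum; sum-replicate-zero)
  open import Algebra.Properties.CommutativeSemigroup +-commutativeSemigroup public
    using () renaming (interchange to +-interchange)
  open import Algebra.Properties.CommutativeSemigroup *-commutativeSemigroup public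
    using () renaming (x∙yz≈y∙xz to x*yz≈y*xz; interchange to *-interchange)
  open import Algebra.Properties.Ring ring public
    using (x[y-z]≈xy-xz; [y-z]x≈yx-zx; -‿distribˡ-*; -‿distribʳ-*)
  open import Algebra.Properties.AbelianGroup +-abelianGroup public
    using () renaming
      ( ε⁻¹≈ε to -0≈0; ⁻¹-involutive to -‿involutive; ⁻¹-∙-comm to -‿+-comm
      ; x∙y⁻¹≈ε⇒x≈y to x-y≈0⇒x≈y; x≈y⇒x∙y⁻¹≈ε to x≈y⇒x-y≈0
      ; //-rightDividesˡ to x-y+y≈x; //-rightDividesʳ to x+y-y≈x )
  open import Relation.Binary.Reasoning.Setoid setoid
  open IsStrictPartialOrder isStrictPartialOrder public
    using (<-resp-≈) renaming (irrefl to <-irrefl; trans to <-trans)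

  <-respˡ : ∀ {x y z} → x ≈ y → x < z → y < z
  <-respˡ = proj₂ <-resp-≈

  <-respʳ : ∀ {x y z} → x ≈ y → z < x → z < y
  <-respʳ = proj₁ <-resp-≈

  <-asym : ∀ {x y} → x < y → ¬ y < x
  <-asym x<y y<x = <-irrefl refl (<-trans x<y y<x)

  -- If neither strict order holds, the elements are not apart, and tightness makes them equal. The
  -- double negation costs nothing where the goal is `≤`, a negation, or `≈`, which is stable.
  <-trichotomy : ∀ x y → ¬ ¬ (x < y ⊎ x ≈ y ⊎ y < x)
  <-trichotomy x y k = k (inj₂ (inj₁ (proj₁ (tight x y)
    λ x#y → k ([ inj₁ , inj₂ ∘ inj₂ ]′ (#⇒<⊎> x#y)))))

  ≈-stable : ∀ {x y} → ¬ ¬ x ≈ y → x ≈ y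
  ≈-stable {x} {y} nn = proj₁ (tight x y) λ x#y → nn λ x≈y → proj₂ (tight x y) x≈y x#y

  ≤-antisym : ∀ {x y} → x ≤ y → y ≤ x → x ≈ y
  ≤-antisym x≤y y≤x = ≈-stable λ x≉y → <-trichotomy _ _ λ where
    (inj₁ x<y)        → y≤x x<y
    (inj₂ (inj₁ x≈y)) → x≉y x≈y
    (inj₂ (inj₂ y<x)) → x≤y y<x

  ≤-reflexive : ∀ {x y} → x ≈ y → x ≤ y
  ≤-reflexive x≈y = <-irrefl (sym x≈y)

  <⇒≤ : ∀ {x y} → x < y → x ≤ y
  <⇒≤ = <-asym

  ≤-trans : ∀ {x y z} → x ≤ y → y ≤ z → x ≤ z
  ≤-trans x≤y y≤z z<x = <-trichotomy _ _ λ where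
    (inj₁ y<x)        → x≤y y<x
    (inj₂ (inj₁ y≈x)) → y≤z (<-respʳ (sym y≈x) z<x)
    (inj₂ (inj₂ x<y)) → y≤z (<-trans z<x x<y)

  ≤-respˡ : ∀ {x y z} → x ≈ y → x ≤ z → y ≤ z
  ≤-respˡ x≈y x≤z = x≤z ∘ <-respʳ (sym x≈y)

  ≤-respʳ : ∀ {x y z} → x ≈ y → z ≤ x → z ≤ y
  ≤-respʳ x≈y z≤x = z≤x ∘ <-respˡ (sym x≈y)

  ≤∧≉⇒< : ∀ {x y} → x ≤ y → ¬ x ≈ y → ¬ ¬ x < y
  ≤∧≉⇒< x≤y x≉y k = x≉y (≤-antisym x≤y k)

  x<y⇒0<y-x : ∀ {x y} → x < y → 0# < y - x
  x<y⇒0<y-x x<y = <-respˡ (-‿inverseʳ _) (+-monoˡ-< (- _) x<y)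

  0<y-x⇒x<y : ∀ {x y} → 0# < y - x → x < y
  0<y-x⇒x<y {x} {y} lt = <-respˡ (+-identityˡ x) (<-respʳ (x-y+y≈x x y) (+-monoˡ-< x lt))

  x≤y⇒0≤y-x : ∀ {x y} → x ≤ y → 0# ≤ y - x
  x≤y⇒0≤y-x {x} {y} x≤y lt = x≤y (<-respˡ (x-y+y≈x x y) (<-respʳ (+-identityˡ x) (+-monoˡ-< x lt)))

  0≤y-x⇒x≤y : ∀ {x y} → 0# ≤ y - x → x ≤ y
  0≤y-x⇒x≤y le y<x = le (<-respʳ (-‿inverseʳ _) (+-monoˡ-< (- _) y<x))

  +-monoˡ-≤ : ∀ {x y} w → x ≤ y → x + w ≤ y + w
  +-monoˡ-≤ {x} {y} w x≤y lt =
    x≤y (<-respˡ (x+y-y≈x w y) (<-respʳ (x+y-y≈x w x) (+-monoˡ-< (- w) lt)))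

  +-nonneg : ∀ {x y} → 0# ≤ x → 0# ≤ y → 0# ≤ x + y
  +-nonneg {x} {y} 0≤x 0≤y = ≤-trans 0≤y (≤-respˡ (+-identityˡ y) (+-monoˡ-≤ y 0≤x))

  *-nonneg : ∀ {x y} → 0# ≤ x → 0# ≤ y → 0# ≤ x * y
  *-nonneg {x} {y} 0≤x 0≤y xy<0 = <-trichotomy 0# x λ where
    (inj₂ (inj₂ x<0)) → 0≤x x<0
    (inj₂ (inj₁ 0≈x)) → <-irrefl (trans (*-congʳ (sym 0≈x)) (zeroˡ y)) xy<0
    (inj₁ 0<x)        → <-trichotomy 0# y λ where
      (inj₂ (inj₂ y<0)) → 0≤y y<0
      (inj₂ (inj₁ 0≈y)) → <-irrefl (trans (*-congˡ (sym 0≈y)) (zeroʳ x)) xy<0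
      (inj₁ 0<y)        → <-asym (*-pos 0<x 0<y) xy<0

  -x*-x≈x*x : ∀ x → - x * - x ≈ x * x
  -x*-x≈x*x x = begin
    - x * - x     ≈⟨ -‿distribˡ-* x (- x) ⟨
    - (x * - x)   ≈⟨ -‿cong (-‿distribʳ-* x x) ⟨
    - - (x * x)   ≈⟨ -‿involutive (x * x) ⟩
    x * x         ∎

  square-nonneg : ∀ x → 0# ≤ x * x
  square-nonneg x lt = <-trichotomy 0# x λ where
    (inj₁ 0<x)        → *-nonneg (<⇒≤ 0<x) (<⇒≤ 0<x) lt
    (inj₂ (inj₁ 0≈x)) → <-irrefl (trans (*-congʳ (sym 0≈x)) (zeroˡ x)) lt
    (inj₂ (inj₂ x<0)) →
      let 0≤-x = <⇒≤ (<-respʳ (+-identityˡ (- x)) (x<y⇒0<y-x x<0))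
      in *-nonneg 0≤-x 0≤-x (<-respˡ (sym (-x*-x≈x*x x)) lt)

  -- Invertibility of 1 - 0 makes 1 apart from 0, and the order 1 < 0 would make the square of 1
  -- negative.
  0<1 : 0# < 1#
  0<1 with #⇒<⊎> (invertible⇒# {1#} {0#} (1# , 1*[1-0]≈1 , trans (*-comm _ _) 1*[1-0]≈1))
    where
    1*[1-0]≈1 : 1# * (1# - 0#) ≈ 1#
    1*[1-0]≈1 = trans (*-identityˡ _) (trans (+-congˡ -0≈0) (+-identityʳ 1#))
  ... | inj₂ 0<1 = 0<1
  ... | inj₁ 1<0 = contradiction (<-respˡ (sym (*-identityʳ 1#)) 1<0) (square-nonneg 1#)

  *-monoˡ-≤ : ∀ {x y} w → 0# ≤ w → x ≤ y → w * x ≤ w * y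
  *-monoˡ-≤ w 0≤w x≤y = 0≤y-x⇒x≤y (≤-respʳ (x[y-z]≈xy-xz w _ _) (*-nonneg 0≤w (x≤y⇒0≤y-x x≤y)))

  *-cancelˡ-≤ : ∀ {x y} w → 0# < w → w * x ≤ w * y → x ≤ y
  *-cancelˡ-≤ w 0<w le y<x =
    le (0<y-x⇒x<y (<-respʳ (x[y-z]≈xy-xz w _ _) (*-pos 0<w (x<y⇒0<y-x y<x))))

  x*y≈0⇒y≈0 : ∀ {x y} → 0# < x → 0# ≤ y → x * y ≈ 0# → y ≈ 0#
  x*y≈0⇒y≈0 {x} 0<x 0≤y xy≈0 =
    ≤-antisym (*-cancelˡ-≤ x 0<x (≤-reflexive (trans xy≈0 (sym (zeroʳ x))))) 0≤y

  x+y≈0⇒x≈0 : ∀ {x y} → 0# ≤ x → 0# ≤ y → x + y ≈ 0# → x ≈ 0#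
  x+y≈0⇒x≈0 {x} {y} 0≤x 0≤y eq = ≤-antisym
    (≤-respˡ (+-identityˡ x) (≤-respʳ (trans (+-comm y x) eq) (+-monoˡ-≤ x 0≤y))) 0≤x

  sum-nonneg : ∀ {n} (f : Fin n → Carrier) → (∀ i → 0# ≤ f i) → 0# ≤ sum f
  sum-nonneg {ℕ.zero}  f 0≤f = <-irrefl refl
  sum-nonneg {ℕ.suc n} f 0≤f = +-nonneg (0≤f zero) (sum-nonneg (f ∘ suc) (0≤f ∘ suc))

  sum≈0⇒≈0 : ∀ {n} (f : Fin n → Carrier) → (∀ i → 0# ≤ f i) → sum f ≈ 0# → ∀ i → f i ≈ 0#
  sum≈0⇒≈0 f 0≤f eq zero    = x+y≈0⇒x≈0 (0≤f zero) (sum-nonneg (f ∘ suc) (0≤f ∘ suc)) eq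
  sum≈0⇒≈0 f 0≤f eq (suc i) = sum≈0⇒≈0 (f ∘ suc) (0≤f ∘ suc)
    (x+y≈0⇒x≈0 (sum-nonneg (f ∘ suc) (0≤f ∘ suc)) (0≤f zero) (trans (+-comm _ _) eq)) i

  sum-zero : ∀ {n} (f : Fin n → Carrier) → (∀ i → f i ≈ 0#) → sum f ≈ 0#
  sum-zero {n} f f≈0 = trans (sum-cong-≋ f≈0) (sum-replicate-zero n)

  sum-neg : ∀ {n} (f : Fin n → Carrier) → sum (λ i → - f i) ≈ - sum f
  sum-neg {ℕ.zero}  f = sym -0≈0
  sum-neg {ℕ.suc n} f = trans (+-congˡ (sum-neg (f ∘ suc))) (-‿+-comm (f zero) _)

  [w+x]-[y+v]≈[w-y]+[x-v] : ∀ w x y v → (w + x) - (y + v) ≈ (w - y) + (x - v)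
  [w+x]-[y+v]≈[w-y]+[x-v] w x y v = trans (+-congˡ (sym (-‿+-comm y v))) (+-interchange w x (- y) (- v))

  [w-x]-[y-v]≈[w-y]-[x-v] : ∀ w x y v → (w - x) - (y - v) ≈ (w - y) - (x - v)
  [w-x]-[y-v]≈[w-y]-[x-v] w x y v = trans ([w+x]-[y+v]≈[w-y]+[x-v] w (- x) y (- v)) (+-congˡ (-‿+-comm x (- v)))

  sum-sub : ∀ {n} (f g : Fin n → Carrier) → sum (λ i → f i - g i) ≈ sum f - sum g
  sum-sub f g = trans (∑-distrib-+ f (λ i → - g i)) (+-congˡ (sum-neg g))

-- Slacks, faces and facets of a polytope given by its vertices.

module PolytopeProperties {c ℓ₁ ℓ₂ ℓ₃} (𝔽 : OrderedField c ℓ₁ ℓ₂ ℓ₃) where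

  open OrderedFieldProperties 𝔽
  open Geometry 𝔽
  open Halfspace
  open import Relation.Binary.Reasoning.Setoid setoid

  sum-weights : ∀ {s} (w : Fin s → Carrier) → sum w ≈ 1# → ∀ x → sum (λ t → w t * x) ≈ x
  sum-weights w total x = begin
    sum (λ t → w t * x)   ≈⟨ *-distribʳ-sum x w ⟨
    sum w * x             ≈⟨ *-congʳ total ⟩
    1# * x                ≈⟨ *-identityˡ x ⟩
    x                     ∎

  ∑-*-comm : ∀ {s d} (n : Fin d → Carrier) (w : Fin s → Carrier) (f : Fin s → Fin d → Carrier) →
             sum (λ a → n a * sum (λ t → w t * f t a)) ≈ sum (λ t → w t * sum (λ a → n a * f t a))
  ∑-*-comm n w f = begin
    sum (λ a → n a * sum (λ t → w t * f t a))
      ≈⟨ sum-cong-≋ (λ a → trans (*-distribˡ-sum (n a) (λ t → w t * f t a))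
           (sum-cong-≋ λ t → x*yz≈y*xz (n a) (w t) (f t a))) ⟩
    sum (λ a → sum (λ t → w t * (n a * f t a)))
      ≈⟨ ∑-comm (λ a t → w t * (n a * f t a)) ⟩
    sum (λ t → sum (λ a → w t * (n a * f t a)))
      ≈⟨ sum-cong-≋ (λ t → *-distribˡ-sum (w t) (λ a → n a * f t a)) ⟨
    sum (λ t → w t * sum (λ a → n a * f t a)) ∎

  vertex∈Conv : ∀ {X S} (p : S → Point X) s → Conv p (p s)
  vertex∈Conv p s = record
    { size        = 1
    ; weight      = λ _ → 1#
    ; pick        = λ _ → s
    ; nonneg      = λ _ → <⇒≤ 0<1
    ; total       = +-identityʳ 1#
    ; combination = λ a → sym (trans (+-identityʳ _) (*-identityˡ (p s a)))
    }

  slack : ∀ {d} → Halfspace d → Point (Fin d) → Carrier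
  slack h y = bound h - evaluate h y

  module _ {d m} (p : Fin m → Point (Fin d)) where

    Valid : Halfspace d → Set ℓ₃
    Valid h = ∀ j → 0# ≤ slack h (p j)

    Tight : Halfspace d → Fin m → Set ℓ₁
    Tight h j = slack h (p j) ≈ 0#

    -- As the weights add up to 1, the bound can be distributed over the terms together with the
    -- linear part. Validity and tightness may therefore be tested at the vertices.
    slack-combination : ∀ h {y} (y∈ : Conv p y) →
      slack h y ≈ sum (λ t → Conv.weight y∈ t * slack h (p (Conv.pick y∈ t)))
    slack-combination h {y} y∈ = begin
      bound h - evaluate h y
        ≈⟨ +-congˡ (-‿cong (sum-cong-≋ λ a → *-congˡ (combination a))) ⟩
      bound h - sum (λ a → normal h a * sum (λ t → weight t * p (pick t) a))
        ≈⟨ +-congˡ (-‿cong (∑-*-comm (normal h) weight (p ∘ pick))) ⟩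
      bound h - sum (λ t → weight t * evaluate h (p (pick t)))
        ≈⟨ +-congʳ (sum-weights weight total (bound h)) ⟨
      sum (λ t → weight t * bound h) - sum (λ t → weight t * evaluate h (p (pick t)))
        ≈⟨ sum-sub (λ t → weight t * bound h) (λ t → weight t * evaluate h (p (pick t))) ⟨
      sum (λ t → weight t * bound h - weight t * evaluate h (p (pick t)))
        ≈⟨ sum-cong-≋ (λ t → x[y-z]≈xy-xz (weight t) (bound h) _) ⟨
      sum (λ t → weight t * slack h (p (pick t))) ∎
      where open Conv y∈

    weighted-slack-nonneg : ∀ {h} → Valid h → ∀ {y} (y∈ : Conv p y) t →
      0# ≤ Conv.weight y∈ t * slack h (p (Conv.pick y∈ t))
    weighted-slack-nonneg valid y∈ t = *-nonneg (Conv.nonneg y∈ t) (valid (Conv.pick y∈ t))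

    slack-nonneg : ∀ {h} → Valid h → ∀ {y} → Conv p y → 0# ≤ slack h y
    slack-nonneg {h} valid y∈ =
      ≤-respʳ (sym (slack-combination h y∈)) (sum-nonneg _ (weighted-slack-nonneg {h} valid y∈))

    slack≈0⇒∈Face : ∀ h {y} → Conv p y → slack h y ≈ 0# → Face (Conv p) h y
    slack≈0⇒∈Face h y∈ eq = y∈ , sym (x-y≈0⇒x≈y _ _ eq)

    ∈Face⇒slack≈0 : ∀ h {y} → Face (Conv p) h y → slack h y ≈ 0#
    ∈Face⇒slack≈0 h (_ , eq) = x≈y⇒x-y≈0 (sym eq)

    -- Slack zero at a point is a vanishing sum of nonnegative terms, so every vertex of positive
    -- weight is tight for `g`, hence for `h`. With the converse below, inclusion of faces becomes
    -- inclusion of finite vertex sets.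
    Tight⊆⇒Face⊆ : ∀ {g h} → Valid g → (∀ j → Tight g j → Tight h j) → Face (Conv p) g ⊆ Face (Conv p) h
    Tight⊆⇒Face⊆ {g} {h} valid tight {y} y∈F@(y∈ , _) = slack≈0⇒∈Face h y∈
      (trans (slack-combination h y∈) (sum-zero _ zero-term))
      where
      open Conv y∈
      zero-term : ∀ t → weight t * slack h (p (pick t)) ≈ 0#
      zero-term t = ≈-stable λ nonzero → ≤∧≉⇒< (nonneg t)
        (λ 0≈w → nonzero (trans (*-congʳ (sym 0≈w)) (zeroˡ _)))
        (λ 0<w → nonzero (trans (*-congˡ (tight (pick t) (x*y≈0⇒y≈0 0<w (valid (pick t))
          (sum≈0⇒≈0 _ (weighted-slack-nonneg {g} valid y∈)
            (trans (sym (slack-combination g y∈)) (∈Face⇒slack≈0 g y∈F)) t)))) (zeroʳ _)))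

    Face⊆⇒Tight⊆ : ∀ {g h} → Face (Conv p) g ⊆ Face (Conv p) h → ∀ j → Tight g j → Tight h j
    Face⊆⇒Tight⊆ {g} {h} sub j tight = ∈Face⇒slack≈0 h (sub (slack≈0⇒∈Face g (vertex∈Conv p j) tight))

    proper⇒Valid : ∀ {h} → IsProperFace (Conv p) h → Valid h
    proper⇒Valid (below , _) j = x≤y⇒0≤y-x (below (p j) (vertex∈Conv p j))

    Valid⇒proper : ∀ {h y} → Valid h → Conv p y → ¬ slack h y ≈ 0# → IsProperFace (Conv p) h
    Valid⇒proper {h} valid y∈ loose =
        (λ x x∈ → 0≤y-x⇒x≤y (slack-nonneg {h} valid x∈))
      , (λ all → loose (∈Face⇒slack≈0 h (all y∈)))

    -- If no vertex had positive slack, all would be tight and the whole polytope would lie in the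
    -- face.
    proper⇒loose-vertex : ∀ {h} → IsProperFace (Conv p) h → ¬ ¬ (∃[ j ] 0# < slack h (p j))
    proper⇒loose-vertex {h} proper@(_ , ¬all) none = ¬all λ {y} y∈ → slack≈0⇒∈Face h y∈
      (trans (slack-combination h y∈) (sum-zero (λ t → Conv.weight y∈ t * slack h (p (Conv.pick y∈ t))) λ t →
        trans (*-congˡ (≤-antisym (λ 0<s → none (_ , 0<s)) (proper⇒Valid {h} proper _))) (zeroʳ _)))

  -- l minimises a j / b j over the j with b j > 0; the denominators are cleared.
  minimal-ratio : ∀ {m} (a b : Fin m → Carrier) → (∀ j → 0# ≤ a j) → (∀ j → 0# ≤ b j) →
    ∀ i → 0# < b i → ¬ ¬ (∃[ l ] 0# < b l × (∀ j → a l * b j ≤ a j * b l))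
  minimal-ratio {m} a b 0≤a 0≤b i 0<bi k =
    search (List.allFin m) i 0<bi λ (l , 0<bl , _ , least) →
      k (l , 0<bl , λ j → All.lookup least (∈-allFin j))
    where
    _≼_ : Fin m → Fin m → Set ℓ₃
    i ≼ j = a i * b j ≤ a j * b i

    -- Transitivity of the cross-multiplied comparison cancels the middle denominator, which must be
    -- positive; the outer ones need only be nonnegative.
    ≼-trans : ∀ {i j l} → 0# < b j → i ≼ j → j ≼ l → i ≼ l
    ≼-trans {i} {j} {l} 0<bj i≼j j≼l = *-cancelˡ-≤ (b j) 0<bj
      (≤-respˡ (trans (x*yz≈y*xz (b l) (a i) (b j)) (trans (*-congˡ (*-comm _ _)) (x*yz≈y*xz (a i) (b j) (b l))))
        (≤-trans (*-monoˡ-≤ (b l) (0≤b l) i≼j)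
          (≤-respˡ (trans (x*yz≈y*xz (b i) (a j) (b l)) (trans (*-congˡ (*-comm _ _)) (x*yz≈y*xz (a j) (b l) (b i))))
            (≤-respʳ (trans (x*yz≈y*xz (b i) (a l) (b j)) (trans (*-congˡ (*-comm _ _)) (x*yz≈y*xz (a l) (b j) (b i))))
              (*-monoˡ-≤ (b i) (0≤b i) j≼l)))))

    -- Here `i` is the current candidate. The result is also compared with `i`, so that an entry
    -- already passed can be compared with it through `i`.
    search : ∀ js i → 0# < b i → ¬ ¬ (∃[ l ] 0# < b l × l ≼ i × All (l ≼_) js)
    search []       i 0<bi k = k (i , 0<bi , <-irrefl refl , [])
    search (j ∷ js) i 0<bi k = ¬¬-excluded-middle λ where
      (yes i≼j) → search js i 0<bi λ (l , 0<bl , l≼i , least) →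
        k (l , 0<bl , l≼i , ≼-trans 0<bi l≼i i≼j ∷ least)
      -- A strictly smaller ratio at `j` forces b j > 0, since b j ≈ 0 would make a j * b i
      -- negative; so `j` is a legitimate new candidate.
      (no i⋠j) → i⋠j λ aj*bi<ai*bj →
        ≤∧≉⇒< (0≤b j)
          (λ 0≈bj → *-nonneg (0≤a j) (0≤b i)
            (<-respʳ (trans (*-congˡ (sym 0≈bj)) (zeroʳ (a i))) aj*bi<ai*bj))
          λ 0<bj → search js j 0<bj λ (l , 0<bl , l≼j , least) →
            k (l , 0<bl , ≼-trans 0<bj l≼j (<⇒≤ aj*bi<ai*bj) , l≼j ∷ least)

  combine : ∀ {d} → Carrier → Halfspace d → Carrier → Halfspace d → Halfspace d
  combine α g β h = record
    { normal = λ i → α * normal g i - β * normal h i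
    ; bound  = α * bound g - β * bound h
    }

  slack-combine : ∀ {d} α g β (h : Halfspace d) y →
                  slack (combine α g β h) y ≈ α * slack g y - β * slack h y
  slack-combine α g β h y = begin
    (α * bound g - β * bound h) - sum (λ i → (α * normal g i - β * normal h i) * y i)
      ≈⟨ +-congˡ (-‿cong evaluate-combine) ⟩
    (α * bound g - β * bound h) - (α * evaluate g y - β * evaluate h y)
      ≈⟨ [w-x]-[y-v]≈[w-y]-[x-v] _ _ _ _ ⟩
    (α * bound g - α * evaluate g y) - (β * bound h - β * evaluate h y)
      ≈⟨ +-cong (x[y-z]≈xy-xz α _ _) (-‿cong (x[y-z]≈xy-xz β _ _)) ⟨
    α * slack g y - β * slack h y ∎
    where
    evaluate-combine : sum (λ i → (α * normal g i - β * normal h i) * y i) ≈ α * evaluate g y - β * evaluate h y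
    evaluate-combine = begin
      sum (λ i → (α * normal g i - β * normal h i) * y i)
        ≈⟨ sum-cong-≋ (λ i → trans ([y-z]x≈yx-zx (y i) _ _)
             (+-cong (*-assoc α _ _) (-‿cong (*-assoc β _ _)))) ⟩
      sum (λ i → α * (normal g i * y i) - β * (normal h i * y i))
        ≈⟨ sum-sub (λ i → α * (normal g i * y i)) (λ i → β * (normal h i * y i)) ⟩
      sum (λ i → α * (normal g i * y i)) - sum (λ i → β * (normal h i * y i))
        ≈⟨ +-cong (*-distribˡ-sum α (λ i → normal g i * y i)) (-‿cong (*-distribˡ-sum β (λ i → normal h i * y i))) ⟨
      α * evaluate g y - β * evaluate h y ∎

  module _ {d m} (p : Fin m → Point (Fin d)) {y : Point (Fin d)} (y∈ : Conv p y) where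

    Avoiding : Halfspace d → Set _
    Avoiding h = Valid p h × ¬ slack h y ≈ 0#

    _⊑_ : Halfspace d → Halfspace d → Set _
    g ⊑ h = ∀ j → Tight p g j → Tight p h j

    -- Maximality is split over the vertices: no inequality that still avoids `y` and keeps the
    -- tight vertices can gain `j`. Each vertex can then be treated once.
    MaximalAt : Halfspace d → Fin m → Set _
    MaximalAt h j = ∀ g → Avoiding g → h ⊑ g → Tight p g j → Tight p h j

    -- One pass over the vertices suffices. Either some admissible inequality above the current one
    -- is tight at `j` and replaces it, or none is, and this persists while the tight set grows.
    maximal-avoiding : ∀ h → Avoiding h →
      ¬ ¬ (∃[ g ] Avoiding g × h ⊑ g × (∀ j → MaximalAt g j))
    maximal-avoiding h avoiding k = extend (List.allFin m) h avoiding λ (g , av , h⊑g , maximal) →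
      k (g , av , h⊑g , λ j → All.lookup maximal (∈-allFin j))
      where
      extend : ∀ js h → Avoiding h → ¬ ¬ (∃[ g ] Avoiding g × h ⊑ g × All (MaximalAt g) js)
      extend []       h avoiding k = k (h , avoiding , (λ _ tight → tight) , [])
      extend (j ∷ js) h avoiding k = ¬¬-excluded-middle {A = ∃[ g ] Avoiding g × h ⊑ g × Tight p g j} λ where
        (yes (g , av , h⊑g , tight)) → extend js g av λ (f , av′ , g⊑f , maximal) →
          k (f , av′ , (λ i → g⊑f i ∘ h⊑g i) , (λ _ _ _ _ → g⊑f j tight) ∷ maximal)
        (no none) → extend js h avoiding λ (f , av′ , h⊑f , maximal) →
          k (f , av′ , h⊑f , (λ g av f⊑g tight → contradiction (g , av , (λ i → f⊑g i ∘ h⊑f i) , tight) none) ∷ maximal)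

    -- If a larger proper face g contained y, then subtracting from h the largest
    -- multiple of g that keeps it valid would make a further vertex tight
    -- without changing the slack at y up to a positive factor.
    maximal-avoiding⇒facet : ∀ h → Avoiding h → (∀ j → MaximalAt h j) → IsFacet (Conv p) h
    maximal-avoiding⇒facet h avoiding@(valid , loose) maximal =
      Valid⇒proper p {h} valid y∈ loose , λ g proper h⊆g →
        Tight⊆⇒Face⊆ p {g} {h} (proper⇒Valid p {g} proper)
          λ j tight → ≈-stable λ ¬tight → no-larger g proper (Face⊆⇒Tight⊆ p {h} {g} h⊆g) j tight ¬tight
      where
      no-larger : ∀ g → IsProperFace (Conv p) g → h ⊑ g → ∀ j → Tight p g j → ¬ ¬ Tight p h j
      no-larger g proper h⊑g j tight-g ¬tight-h = proper⇒loose-vertex p {g} proper λ (i , 0<gi) →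
        minimal-ratio (slack h ∘ p) (slack g ∘ p) valid (proper⇒Valid p {g} proper) i 0<gi λ (l , 0<gl , least) →
        let α = slack g (p l)
            β = slack h (p l)
            s = combine α h β g
            valid-s : Valid p s
            valid-s j = ≤-respʳ (sym (slack-combine α h β g (p j)))
              (x≤y⇒0≤y-x (≤-respʳ (*-comm _ α) (least j)))
            loose-s : ¬ slack s y ≈ 0#
            loose-s eq = loose (x*y≈0⇒y≈0 0<gl (slack-nonneg p {h} valid y∈) (begin
              α * slack h y                   ≈⟨ +-identityʳ _ ⟨
              α * slack h y + 0#              ≈⟨ +-congˡ -0≈0 ⟨
              α * slack h y - 0#              ≈⟨ +-congˡ (-‿cong (zeroʳ β)) ⟨
              α * slack h y - β * 0#          ≈⟨ +-congˡ (-‿cong (*-congˡ g-tight-at-y)) ⟨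
              α * slack h y - β * slack g y   ≈⟨ slack-combine α h β g y ⟨
              slack s y                       ≈⟨ eq ⟩
              0#                              ∎))
            h⊑s : h ⊑ s
            h⊑s j tight = begin
              slack s (p j)                           ≈⟨ slack-combine α h β g (p j) ⟩
              α * slack h (p j) - β * slack g (p j)   ≈⟨ +-cong (*-congˡ tight) (-‿cong (*-congˡ (h⊑g j tight))) ⟩
              α * 0# - β * 0#                         ≈⟨ +-cong (zeroʳ α) (trans (-‿cong (zeroʳ β)) -0≈0) ⟩
              0# + 0#                                 ≈⟨ +-identityʳ 0# ⟩
              0#                                      ∎
            tight-s : Tight p s l
            tight-s = trans (slack-combine α h β g (p l)) (x≈y⇒x-y≈0 (*-comm α β))
        -- Maximality of `h` at `l` makes `h` tight there, hence also `g`, whose slack at `l` is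
        -- positive.
        in <-irrefl (sym (h⊑g l (maximal l s (valid-s , loose-s) h⊑s tight-s))) 0<gl
        where
        -- Were `g` loose at `y`, it would compete with `h`, and maximality would make `h` tight at
        -- `j`.
        g-tight-at-y : slack g y ≈ 0#
        g-tight-at-y = ≈-stable λ loose-g →
          ¬tight-h (maximal j g (proper⇒Valid p {g} proper , loose-g) h⊑g tight-g)

    -- The maximal inequality defines a facet, which `exhaustive` matches with a listed one as a set
    -- of points. This is the nontrivial half of a face being the intersection of its facets: each
    -- point outside the face is missed by one of them.
    separating-facet : ∀ {k} (facets : HasFacets (Conv p) k) h → Avoiding h →
      let open HasFacets facets in
      ¬ ¬ (∃[ i ] (Face (Conv p) h ⊆ Face (Conv p) (facet i)) × ¬ Face (Conv p) (facet i) y)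
    separating-facet facets h avoiding k =
      maximal-avoiding h avoiding λ (g , av , h⊑g , maximal) →
        let i , g⊆ , ⊆g = HasFacets.exhaustive facets g (maximal-avoiding⇒facet g av maximal)
        in k ( i
             , (λ x∈ → g⊆ (Tight⊆⇒Face⊆ p {h} {g} (proj₁ avoiding) h⊑g x∈))
             , (λ y∈F → proj₂ av (∈Face⇒slack≈0 p g (⊆g y∈F))))

-- Double negation over finite ranges, and decisions over Boolean vectors.

private
  variable
    ℓ : Level

-- The double-negation shift, available because the range is finite.
¬¬-∀Fin : ∀ {k} {P : Fin k → Set ℓ} → (∀ i → ¬ ¬ P i) → ¬ ¬ (∀ i → P i)
¬¬-∀Fin {k = ℕ.zero}  nn ¬all = ¬all λ ()
¬¬-∀Fin {k = ℕ.suc k} nn ¬all = nn zero λ p₀ → ¬¬-∀Fin (nn ∘ suc) λ ps →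
  ¬all λ where zero    → p₀
               (suc i) → ps i

¬¬-∀Vec : ∀ {n} {P : Vec Bool n → Set ℓ} → (∀ v → ¬ ¬ P v) → ¬ ¬ (∀ v → P v)
¬¬-∀Vec {n = ℕ.zero}  nn ¬all = nn [] λ p → ¬all λ where [] → p
¬¬-∀Vec {n = ℕ.suc n} nn ¬all = ¬¬-∀Vec (nn ∘ (false ∷_)) λ pf → ¬¬-∀Vec (nn ∘ (true ∷_)) λ pt →
  ¬all λ where (false ∷ v) → pf v
               (true ∷ v)  → pt v

∀Vec? : ∀ {n} {P : Vec Bool n → Set ℓ} → (∀ v → Dec (P v)) → Dec (∀ v → P v)
∀Vec? {n = ℕ.zero}  P? = map′ (λ where p [] → p) (λ p → p []) (P? [])
∀Vec? {n = ℕ.suc n} P? = map′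
  (λ where (pf , pt) (false ∷ v) → pf v
           (pf , pt) (true ∷ v)  → pt v)
  (λ p → p ∘ (false ∷_) , p ∘ (true ∷_))
  (∀Vec? (P? ∘ (false ∷_)) ×-dec ∀Vec? (P? ∘ (true ∷_)))

_≟ⱽ_ : ∀ {n} (v w : Vec Bool n) → Dec (v ≡ w)
_≟ⱽ_ = Vec.≡-dec Bool._≟_

#occurrences : ∀ {𝕋} → List (Tuple 𝕋) → Vec Bool (Template.arity 𝕋) → ℕ
#occurrences bs v = sumℕ (List.map (λ b → ⟦ does (v ≟ⱽ Tuple.entries b) ⟧) bs)

-- Decided by evaluation at all 32 vectors. The parameter `ϑ` enters only the probability table, so
-- the list of tuples computes while `ϑ` is a variable.
occurs-once : ∀ ϑ v → T (switch v) → #occurrences (tuples (switchTemplate ϑ)) v ≡ 1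
occurs-once ϑ = from-yes (∀Vec? λ v → T? (switch v) →-dec (#occurrences (tuples (switchTemplate ϑ)) v ℕ.≟ 1))

-- The slack matrix of an extension, and the squares on the marginal polytope.

module SwitchPolytope {c ℓ₁ ℓ₂ ℓ₃} (𝔽 : OrderedField c ℓ₁ ℓ₂ ℓ₃) where

  open OrderedFieldProperties 𝔽
  open PolytopeProperties 𝔽
  open Geometry 𝔽
  open import Algebra.Properties.Ring ring using (-1*x≈-x)
  open import Algebra.Definitions.RawMonoid +-rawMonoid using () renaming (_×_ to _·_)
  open import Relation.Binary.Reasoning.Setoid setoid

  infixr 6 _⊕_
  infixr 7 _⊛_

  -- Functionals are kept as expressions: pulling one back along an affine map requires its
  -- coefficients, while `X` comes with no enumeration over which a coefficient vector could be
  -- summed.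
  data Affine (X : Set) : Set c where
    const : Carrier → Affine X
    coord : X → Affine X
    _⊕_   : Affine X → Affine X → Affine X
    _⊛_   : Carrier → Affine X → Affine X
    ⨁     : ∀ {n} → (Fin n → Affine X) → Affine X

  eval : ∀ {X} → Affine X → Point X → Carrier
  eval (const α) y = α
  eval (coord a) y = y a
  eval (e ⊕ f)   y = eval e y + eval f y
  eval (α ⊛ e)   y = α * eval e y
  eval (⨁ e)     y = sum (λ i → eval (e i) y)

  eval-cong : ∀ {X} (e : Affine X) {x y} → x ≋ y → eval e x ≈ eval e y
  eval-cong (const α) x≋y = refl
  eval-cong (coord a) x≋y = x≋y a
  eval-cong (e ⊕ f)   x≋y = +-cong (eval-cong e x≋y) (eval-cong f x≋y)
  eval-cong (α ⊛ e)   x≋y = *-congˡ (eval-cong e x≋y)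
  eval-cong (⨁ e)     x≋y = sum-cong-≋ λ i → eval-cong (e i) x≋y

  eval-Conv : ∀ {X S} {p : S → Point X} (e : Affine X) {x} (x∈ : Conv p x) →
              eval e x ≈ sum (λ t → Conv.weight x∈ t * eval e (p (Conv.pick x∈ t)))
  eval-Conv (const α) x∈ = sym (sum-weights (Conv.weight x∈) (Conv.total x∈) α)
  eval-Conv (coord a) x∈ = Conv.combination x∈ a
  eval-Conv {p = p} (e ⊕ f) x∈ = begin
    _                                                 ≈⟨ +-cong (eval-Conv e x∈) (eval-Conv f x∈) ⟩
    sum (λ t → weight t * E t) + sum (λ t → weight t * F t)
                                                      ≈⟨ ∑-distrib-+ (λ t → weight t * E t) (λ t → weight t * F t) ⟨
    sum (λ t → weight t * E t + weight t * F t)       ≈⟨ sum-cong-≋ (λ t → distribˡ (weight t) (E t) (F t)) ⟨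
    sum (λ t → weight t * (E t + F t))                ∎
    where
    open Conv x∈
    E F : Fin size → Carrier
    E t = eval e (p (pick t))
    F t = eval f (p (pick t))
  eval-Conv {p = p} (α ⊛ e) x∈ = begin
    _                                       ≈⟨ *-congˡ (eval-Conv e x∈) ⟩
    α * sum (λ t → weight t * E t)          ≈⟨ *-distribˡ-sum α (λ t → weight t * E t) ⟩
    sum (λ t → α * (weight t * E t))        ≈⟨ sum-cong-≋ (λ t → x*yz≈y*xz α (weight t) (E t)) ⟩
    sum (λ t → weight t * (α * E t))        ∎
    where
    open Conv x∈
    E : Fin size → Carrier
    E t = eval e (p (pick t))
  eval-Conv {p = p} (⨁ e) x∈ = begin
    _                                             ≈⟨ sum-cong-≋ (λ i → eval-Conv (e i) x∈) ⟩
    sum (λ i → sum (λ t → weight t * E i t))      ≈⟨ ∑-comm (λ i t → weight t * E i t) ⟩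
    sum (λ t → sum (λ i → weight t * E i t))      ≈⟨ sum-cong-≋ (λ t → *-distribˡ-sum (weight t) (λ i → E i t)) ⟨
    sum (λ t → weight t * sum (λ i → E i t))      ∎
    where
    open Conv x∈
    E : _ → Fin size → Carrier
    E i t = eval (e i) (p (pick t))

  module _ {X : Set} {d} (M : X → Fin d → Carrier) (o : X → Carrier) where

    affineMap : Point (Fin d) → Point X
    affineMap y a = sum (λ b → M a b * y b) + o a

    linearPart : Affine X → Fin d → Carrier
    linearPart (const α) b = 0#
    linearPart (coord a) b = M a b
    linearPart (e ⊕ f)   b = linearPart e b + linearPart f b
    linearPart (α ⊛ e)   b = α * linearPart e b
    linearPart (⨁ e)     b = sum (λ i → linearPart (e i) b)

    constantPart : Affine X → Carrier
    constantPart (const α) = α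
    constantPart (coord a) = o a
    constantPart (e ⊕ f)   = constantPart e + constantPart f
    constantPart (α ⊛ e)   = α * constantPart e
    constantPart (⨁ e)     = sum (λ i → constantPart (e i))

    eval-affineMap : ∀ e y → eval e (affineMap y) ≈ sum (λ b → linearPart e b * y b) + constantPart e
    eval-affineMap (const α) y = sym (trans (+-congʳ (sum-zero (λ b → 0# * y b) (λ b → zeroˡ (y b)))) (+-identityˡ α))
    eval-affineMap (coord a) y = refl
    eval-affineMap (e ⊕ f)   y = begin
      eval e (affineMap y) + eval f (affineMap y)
        ≈⟨ +-cong (eval-affineMap e y) (eval-affineMap f y) ⟩
      (sum (λ b → linearPart e b * y b) + constantPart e) + (sum (λ b → linearPart f b * y b) + constantPart f)
        ≈⟨ +-interchange _ _ _ _ ⟩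
      (sum (λ b → linearPart e b * y b) + sum (λ b → linearPart f b * y b)) + (constantPart e + constantPart f)
        ≈⟨ +-congʳ (∑-distrib-+ (λ b → linearPart e b * y b) (λ b → linearPart f b * y b)) ⟨
      sum (λ b → linearPart e b * y b + linearPart f b * y b) + (constantPart e + constantPart f)
        ≈⟨ +-congʳ (sum-cong-≋ (λ b → distribʳ (y b) (linearPart e b) (linearPart f b))) ⟨
      sum (λ b → (linearPart e b + linearPart f b) * y b) + (constantPart e + constantPart f) ∎
    eval-affineMap (α ⊛ e)   y = begin
      α * eval e (affineMap y)
        ≈⟨ *-congˡ (eval-affineMap e y) ⟩
      α * (sum (λ b → linearPart e b * y b) + constantPart e)
        ≈⟨ distribˡ α _ _ ⟩
      α * sum (λ b → linearPart e b * y b) + α * constantPart e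
        ≈⟨ +-congʳ (*-distribˡ-sum α (λ b → linearPart e b * y b)) ⟩
      sum (λ b → α * (linearPart e b * y b)) + α * constantPart e
        ≈⟨ +-congʳ (sum-cong-≋ (λ b → *-assoc α (linearPart e b) (y b))) ⟨
      sum (λ b → α * linearPart e b * y b) + α * constantPart e ∎
    eval-affineMap (⨁ e)     y = begin
      sum (λ i → eval (e i) (affineMap y))
        ≈⟨ sum-cong-≋ (λ i → eval-affineMap (e i) y) ⟩
      sum (λ i → sum (λ b → linearPart (e i) b * y b) + constantPart (e i))
        ≈⟨ ∑-distrib-+ (λ i → sum (λ b → linearPart (e i) b * y b)) (λ i → constantPart (e i)) ⟩
      sum (λ i → sum (λ b → linearPart (e i) b * y b)) + sum (λ i → constantPart (e i))
        ≈⟨ +-congʳ (∑-comm (λ i b → linearPart (e i) b * y b)) ⟩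
      sum (λ b → sum (λ i → linearPart (e i) b * y b)) + sum (λ i → constantPart (e i))
        ≈⟨ +-congʳ (sum-cong-≋ (λ b → *-distribʳ-sum (y b) (λ i → linearPart (e i) b))) ⟨
      sum (λ b → sum (λ i → linearPart (e i) b) * y b) + sum (λ i → constantPart (e i)) ∎

    -- A `Halfspace` bounds from above and the functionals are nonnegative; the sign makes the slack
    -- equal to the functional.
    pullback : Affine X → Halfspace d
    pullback e = record { normal = λ b → - linearPart e b ; bound = constantPart e }

    slack-pullback : ∀ e y → slack (pullback e) y ≈ eval e (affineMap y)
    slack-pullback e y = begin
      constantPart e - sum (λ b → - linearPart e b * y b)
        ≈⟨ +-congˡ (-‿cong (sum-cong-≋ (λ b → -‿distribˡ-* (linearPart e b) (y b)))) ⟨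
      constantPart e - sum (λ b → - (linearPart e b * y b))
        ≈⟨ +-congˡ (-‿cong (sum-neg (λ b → linearPart e b * y b))) ⟩
      constantPart e - - sum (λ b → linearPart e b * y b)
        ≈⟨ +-congˡ (-‿involutive _) ⟩
      constantPart e + sum (λ b → linearPart e b * y b)
        ≈⟨ +-comm _ _ ⟩
      sum (λ b → linearPart e b * y b) + constantPart e
        ≈⟨ eval-affineMap e y ⟨
      eval e (affineMap y) ∎

  -- The facets of the extension cover the support of the slack matrix by
  -- rectangles: facet i covers (a , b) when it contains the face of the pulled
  -- back inequality a but not the lift of the vertex b.
  unique-disjointness-bound : ∀ {X S} {p : S → Point X} {k n} → Extension (Conv p) k →
    (e : Vec Bool n → Affine X) (s : Vec Bool n → S) →
    (∀ a t → 0# ≤ eval (e a) (p t)) →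
    (∀ a b → ∣ a ∩ b ∣ ≡ 1 → eval (e a) (p (s b)) ≈ 0#) →
    (∀ a b → ∣ a ∩ b ∣ ≡ 0 → ¬ eval (e a) (p (s b)) ≈ 0#) →
    3 ℕ.^ n ℕ.≤ k ℕ.* 2 ℕ.^ n
  unique-disjointness-bound {p = p} {k} {n} ext e s valid tight loose =
    -- The bound is decidable, so all the finitely many questions whether a facet contains a face or
    -- misses a lift may be answered together under double negation.
    decidable-stable (_ ℕ.≤? _) λ not-bounded →
    ¬¬-∀Fin (λ i → ¬¬-∀Vec λ a → ¬¬-excluded-middle) λ contains? →
    ¬¬-∀Fin (λ i → ¬¬-∀Vec λ b → ¬¬-excluded-middle) λ misses? →
    not-bounded (bound-from contains? misses?)
    where
    open Extension ext
    open HasFacets hasFacets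

    lift : Vec Bool n → Point (Fin dimension)
    lift b = proj₁ (onto (p (s b)) (vertex∈Conv p (s b)))

    lift∈ : ∀ b → Conv vertices (lift b)
    lift∈ b = proj₁ (proj₂ (onto (p (s b)) (vertex∈Conv p (s b))))

    h : Vec Bool n → Halfspace dimension
    h a = pullback matrix offset (e a)

    slack-lift : ∀ a b → slack (h a) (lift b) ≈ eval (e a) (p (s b))
    slack-lift a b = trans (slack-pullback matrix offset (e a) (lift b))
      (eval-cong (e a) λ x → sym (proj₂ (proj₂ (onto (p (s b)) (vertex∈Conv p (s b)))) x))

    h-valid : ∀ a → Valid vertices (h a)
    h-valid a j = ≤-respʳ (sym (trans (slack-pullback matrix offset (e a) (vertices j)) (eval-Conv (e a) image∈)))
      (sum-nonneg _ λ t → *-nonneg (Conv.nonneg image∈ t) (valid a (Conv.pick image∈ t)))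
      where
      image∈ : Conv p (image (vertices j))
      image∈ = into (vertices j) (vertex∈Conv vertices j)

    Contains : Fin k → Vec Bool n → Set _
    Contains i a = Face (Conv vertices) (h a) ⊆ Face (Conv vertices) (facet i)

    Misses : Fin k → Vec Bool n → Set _
    Misses i b = ¬ Face (Conv vertices) (facet i) (lift b)

    bound-from : (∀ i a → Dec (Contains i a)) → (∀ i b → Dec (Misses i b)) → 3 ℕ.^ n ℕ.≤ k ℕ.* 2 ℕ.^ n
    bound-from contains? misses? = rectangle-cover-bound n k
      (λ i a → isYes (contains? i a)) (λ i b → isYes (misses? i b))
      (λ i a b ta tb meet → toWitness {a? = misses? i b} tb (toWitness {a? = contains? i a} ta
        (slack≈0⇒∈Face vertices (h a) (lift∈ b) (trans (slack-lift a b) (tight a b meet)))))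
      (λ a b disjoint → decidable-stable (Fin.any? λ i → T? _) λ uncovered →
        separating-facet vertices (lift∈ b) hasFacets (h a)
          (h-valid a , λ eq → loose a b disjoint (trans (sym (slack-lift a b)) eq))
          λ (i , contains , misses) → uncovered (i , Equivalence.from T-∧
            (fromWitness {a? = contains? i a} contains , fromWitness {a? = misses? i b} misses)))

  indicator-∧ : ∀ x y → indicator (x ∧ y) ≈ indicator x * indicator y
  indicator-∧ true  y = sym (*-identityˡ _)
  indicator-∧ false y = sym (zeroˡ _)

  indicator-idem : ∀ x → indicator x * indicator x ≈ indicator x
  indicator-idem true  = *-identityˡ 1#
  indicator-idem false = zeroˡ 0#

  sum-indicator-∧ : ∀ {n} (a b : Vec Bool n) →
    sum (λ i → indicator (Vec.lookup a i) * indicator (Vec.lookup b i)) ≈ ∣ a ∩ b ∣ · 1#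
  sum-indicator-∧ []      []      = refl
  sum-indicator-∧ (x ∷ a) (y ∷ b) = trans (+-cong (sym (indicator-∧ x y)) (sum-indicator-∧ a b)) (step (x ∧ y))
    where
    step : ∀ q → indicator q + ∣ a ∩ b ∣ · 1# ≈ (⟦ q ⟧ ℕ.+ ∣ a ∩ b ∣) · 1#
    step true  = refl
    step false = +-identityˡ _

  module Readout (ϑ : ℚ) (G : Hypergraph₃) (W : SwitchVar (Hypergraph₃.V G) → Bool) where

    open Hypergraph₃ G

    I : Instance (switchTemplate ϑ)
    I = switchInstance ϑ G

    scopeValues : Hom I → E → Vec Bool 5
    scopeValues h e = Vec.map (Hom.value h) (Instance.scope I e)

    -- The marginal of the event `q` at a constraint. Both the squares and `project`, which is the
    -- case of two positions compared by `xor`, are instances.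
    readout : (Vec Bool 5 → Bool) → E → Point (Event I W) → Carrier
    readout q e y = List.foldr _+_ 0# (List.map (λ b → indicator (q (Tuple.entries b)) * y (relationEvent e b))
                                                (tuples (switchTemplate ϑ)))

    readoutᴬ : (Vec Bool 5 → Bool) → E → Affine (Event I W)
    readoutᴬ q e = List.foldr _⊕_ (const 0#) (List.map (λ b → indicator (q (Tuple.entries b)) ⊛ coord (relationEvent e b))
                                                       (tuples (switchTemplate ϑ)))

    eval-readoutᴬ : ∀ q e y → eval (readoutᴬ q e) y ≈ readout q e y
    eval-readoutᴬ q e y = go (tuples (switchTemplate ϑ))
      where
      go : ∀ bs → eval (List.foldr _⊕_ (const 0#) (List.map (λ b → indicator (q (Tuple.entries b)) ⊛ coord (relationEvent e b)) bs)) y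
                ≈ List.foldr _+_ 0# (List.map (λ b → indicator (q (Tuple.entries b)) * y (relationEvent e b)) bs)
      go []       = refl
      go (b ∷ bs) = +-congˡ (go bs)

    -- The values of a homomorphism on a scope match exactly one listed tuple, so a single term of
    -- the sum survives.
    readout-marginalVector : ∀ q e h → readout q e (marginalVector h) ≈ indicator (q (scopeValues h e))
    readout-marginalVector q e h = begin
      readout q e (marginalVector h)
        ≈⟨ go (tuples (switchTemplate ϑ)) ⟩
      indicator (q v) * (#occurrences (tuples (switchTemplate ϑ)) v · 1#)
        ≡⟨ ≡.cong (λ m → indicator (q v) * (m · 1#)) (occurs-once ϑ v (Hom.satisfies h e)) ⟩
      indicator (q v) * (1# + 0#)
        ≈⟨ *-congˡ (+-identityʳ 1#) ⟩
      indicator (q v) * 1#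
        ≈⟨ *-identityʳ _ ⟩
      indicator (q v) ∎
      where
      v : Vec Bool 5
      v = scopeValues h e
      go : ∀ bs → List.foldr _+_ 0# (List.map (λ b → indicator (q (Tuple.entries b)) * indicator (does (v ≟ⱽ Tuple.entries b))) bs)
                ≈ indicator (q v) * (#occurrences bs v · 1#)
      go []       = sym (zeroʳ _)
      go (b ∷ bs) with v ≟ⱽ Tuple.entries b
      ... | yes ≡.refl = trans (+-congˡ (go bs)) (sym (distribˡ _ _ _))
      ... | no  _      = trans (+-congʳ (zeroʳ _)) (trans (+-identityˡ _) (go bs))

    eval-readoutᴬ-marginalVector : ∀ q e h → eval (readoutᴬ q e) (marginalVector h) ≈ indicator (q (scopeValues h e))
    eval-readoutᴬ-marginalVector q e h = trans (eval-readoutᴬ q e (marginalVector h)) (readout-marginalVector q e h)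

  -- With x i the value of vertex suc i, the inequalities are the squares
  -- (1 − Σ_{i ∈ a} x i)² ≥ 0.  They are affine in the relation events, since
  -- x i is determined by the hyperedge of {0 , suc i} and x i * x j by the
  -- one of {suc i , suc j}.
  module _ (ϑ : ℚ) (n : ℕ) (W : SwitchVar (Vertex (ℕ.suc n)) → Bool) where

    open Readout ϑ (H (ℕ.suc n)) W

    first second : Vec Bool 5 → Bool
    first  v = Vec.lookup v (suc (suc zero))
    second v = Vec.lookup v (suc (suc (suc zero)))

    vertexValue : Fin n → Affine (Event I W)
    vertexValue i = readoutᴬ second (pair< zero (suc i) (ℕ.s≤s ℕ.z≤n))

    edgeProduct : ∀ i j → .(i Fin.< j) → Affine (Event I W)
    edgeProduct i j i<j = readoutᴬ (λ v → first v ∧ second v) (pair< (suc i) (suc j) (ℕ.s≤s i<j))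

    vertexProduct : Fin n → Fin n → Affine (Event I W)
    vertexProduct i j with Fin.<-cmp i j
    ... | tri< i<j _ _ = edgeProduct i j i<j
    ... | tri≈ _   _ _ = vertexValue i
    ... | tri> _ _ j<i = edgeProduct j i j<i

    value-at : Hom I → Fin n → Bool
    value-at h i = Hom.value h (vertexVar (u (suc i)))

    eval-vertexValue : ∀ h i → eval (vertexValue i) (marginalVector h) ≈ indicator (value-at h i)
    eval-vertexValue h i = eval-readoutᴬ-marginalVector second (pair< zero (suc i) (ℕ.s≤s ℕ.z≤n)) h

    eval-edgeProduct : ∀ h i j .(i<j : i Fin.< j) → eval (edgeProduct i j i<j) (marginalVector h)
                                                  ≈ indicator (value-at h i) * indicator (value-at h j)
    eval-edgeProduct h i j i<j = trans
      (eval-readoutᴬ-marginalVector (λ v → first v ∧ second v) (pair< (suc i) (suc j) (ℕ.s≤s i<j)) h)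
      (indicator-∧ (value-at h i) (value-at h j))

    eval-vertexProduct : ∀ h i j → eval (vertexProduct i j) (marginalVector h)
                                 ≈ indicator (value-at h i) * indicator (value-at h j)
    eval-vertexProduct h i j with Fin.<-cmp i j
    ... | tri< i<j _ _    = eval-edgeProduct h i j i<j
    ... | tri≈ _ ≡.refl _ = trans (eval-vertexValue h i) (sym (indicator-idem (value-at h i)))
    ... | tri> _ _ j<i    = trans (eval-edgeProduct h j i j<i) (*-comm _ _)

    linear quadratic square : Vec Bool n → Affine (Event I W)
    linear    a = ⨁ λ i → indicator (Vec.lookup a i) ⊛ vertexValue i
    quadratic a = ⨁ λ i → ⨁ λ j → (indicator (Vec.lookup a i) * indicator (Vec.lookup a j)) ⊛ vertexProduct i j
    -- This is 1 - 2 L + Q, grouped as (1 - L) - (L - Q); at a vertex Q is the square of L, and the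
    -- grouping factors by distributivity alone.
    square    a = (const 1# ⊕ (- 1#) ⊛ linear a) ⊕ (- 1#) ⊛ (linear a ⊕ (- 1#) ⊛ quadratic a)

    weightOn : Vec Bool n → Hom I → Carrier
    weightOn a h = sum (λ i → indicator (Vec.lookup a i) * indicator (value-at h i))

    eval-square : ∀ a h → eval (square a) (marginalVector h) ≈ (1# - weightOn a h) * (1# - weightOn a h)
    eval-square a h = begin
      (1# + - 1# * L) + - 1# * (L + - 1# * Q)
        ≈⟨ +-cong (+-congˡ (-1*x≈-x L)) (trans (-1*x≈-x _) (-‿cong (+-congˡ (-1*x≈-x Q)))) ⟩
      (1# - L) - (L - Q)
        ≈⟨ +-cong (+-congˡ (-‿cong L≈S)) (-‿cong (+-cong L≈S (-‿cong Q≈S*S))) ⟩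
      (1# - S) - (S - S * S)
        ≈⟨ +-cong (sym (*-identityʳ _)) (-‿cong (trans (+-congʳ (sym (*-identityˡ S))) (sym ([y-z]x≈yx-zx S 1# S)))) ⟩
      (1# - S) * 1# - (1# - S) * S
        ≈⟨ x[y-z]≈xy-xz (1# - S) 1# S ⟨
      (1# - S) * (1# - S) ∎
      where
      L Q S : Carrier
      L = eval (linear a) (marginalVector h)
      Q = eval (quadratic a) (marginalVector h)
      S = weightOn a h
      α : Fin n → Carrier
      α i = indicator (Vec.lookup a i)
      x : Fin n → Carrier
      x i = indicator (value-at h i)
      L≈S : L ≈ S
      L≈S = sum-cong-≋ λ i → *-congˡ (eval-vertexValue h i)
      Q≈S*S : Q ≈ S * S
      Q≈S*S = begin
        Q                                               ≈⟨ sum-cong-≋ (λ i → sum-cong-≋ λ j → *-congˡ (eval-vertexProduct h i j)) ⟩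
        sum (λ i → sum λ j → α i * α j * (x i * x j))   ≈⟨ sum-cong-≋ (λ i → sum-cong-≋ λ j → *-interchange (α i) (α j) (x i) (x j)) ⟩
        sum (λ i → sum λ j → α i * x i * (α j * x j))   ≈⟨ sum-cong-≋ (λ i → *-distribˡ-sum (α i * x i) (λ j → α j * x j)) ⟨
        sum (λ i → α i * x i * S)                       ≈⟨ *-distribʳ-sum S (λ i → α i * x i) ⟨
        S * S                                           ∎

    closedGateHom : Vec Bool n → Hom I
    closedGateHom b = record { value = assignment ; satisfies = λ _ → tt }
      where
      assignment : SwitchVar (Vertex (ℕ.suc n)) → Bool
      assignment (vertexVar (u (suc i))) = Vec.lookup b i
      -- Both gates receive this default and hence agree, so every constraint reduces to `true`
      -- whatever `b` is.
      assignment _                       = false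

    eval-square-closedGateHom : ∀ {m} a b → ∣ a ∩ b ∣ ≡ m →
      eval (square a) (marginalVector (closedGateHom b)) ≈ (1# - m · 1#) * (1# - m · 1#)
    eval-square-closedGateHom a b ≡.refl = trans (eval-square a (closedGateHom b)) (*-cong eq eq)
      where
      eq : 1# - weightOn a (closedGateHom b) ≈ 1# - ∣ a ∩ b ∣ · 1#
      eq = +-congˡ (-‿cong (sum-indicator-∧ a b))

    Marginal-bound : ∀ {k} → Extension (Marginal I W) k → 3 ℕ.^ n ℕ.≤ k ℕ.* 2 ℕ.^ n
    Marginal-bound ext = unique-disjointness-bound ext square closedGateHom
      (λ a h → ≤-respʳ (sym (eval-square a h)) (square-nonneg (1# - weightOn a h)))
      (λ a b meet → trans (eval-square-closedGateHom a b meet)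
        (trans (*-congʳ (trans (+-congˡ (-‿cong (+-identityʳ 1#))) (-‿inverseʳ 1#))) (zeroˡ _)))
      (λ a b disjoint eq → <-irrefl (sym (trans (sym (trans (*-cong 1-0≈1 1-0≈1) (*-identityˡ 1#)))
        (trans (sym (eval-square-closedGateHom a b disjoint)) eq))) 0<1)
      where
      1-0≈1 : 1# - 0# ≈ 1#
      1-0≈1 = trans (+-congˡ -0≈0) (+-identityʳ 1#)

-- Projection of the open-gate face onto the proper-cut face.

ProperlyCuts : ∀ {n} → (Vertex n → Bool) → Pair< n → Set
ProperlyCuts S e = T (NAE₃ (S (hyperedge e zero)) (S (hyperedge e (suc zero))) (S (hyperedge e (suc (suc zero)))))

properlyCuts? : ∀ {n} (S : Vertex n → Bool) e → Dec (ProperlyCuts S e)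
properlyCuts? S e = T? _

allProperlyCut? : ∀ {n} (S : Vertex n → Bool) → Dec (∀ e → ProperlyCuts S e)
allProperlyCut? {n} S = map′
  (λ all e → ≡.subst (ProperlyCuts S) (strictlyInverseʳ e) (all (to e)))
  (λ all i → all (from i))
  (Fin.all? λ i → properlyCuts? S (from i))
  where open Inverse (Pair<↔Fin n)

module FaceProjection {c ℓ₁ ℓ₂ ℓ₃} (𝔽 : OrderedField c ℓ₁ ℓ₂ ℓ₃) (ϑ : ℚ) (n : ℕ) where

  open OrderedFieldProperties 𝔽
  open PolytopeProperties 𝔽
  open SwitchPolytope 𝔽
  open Readout ϑ (H n) isGate
  open Geometry 𝔽
  open import Relation.Binary.Reasoning.Setoid setoid

  -- The weighted gaps are nonnegative and add up to zero, so each vanishes. The conclusion stays a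
  -- product because it cannot be decided whether a weight is zero.
  attains-bound : ∀ {s} {w f : Fin s → Carrier} {α} → (∀ t → 0# ≤ w t) → sum w ≈ 1# →
    (∀ t → f t ≤ α) → sum (λ t → w t * f t) ≈ α → ∀ t → w t * f t ≈ w t * α
  attains-bound {w = w} {f} {α} 0≤w total f≤α eq t =
    sym (x-y≈0⇒x≈y _ _ (trans (sym (x[y-z]≈xy-xz (w t) α (f t)))
      (sum≈0⇒≈0 (λ t → w t * (α - f t)) (λ t → *-nonneg (0≤w t) (x≤y⇒0≤y-x (f≤α t))) (begin
        sum (λ t → w t * (α - f t))                         ≈⟨ sum-cong-≋ (λ t → x[y-z]≈xy-xz (w t) α (f t)) ⟩
        sum (λ t → w t * α - w t * f t)                     ≈⟨ sum-sub (λ t → w t * α) (λ t → w t * f t) ⟩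
        sum (λ t → w t * α) - sum (λ t → w t * f t)         ≈⟨ +-cong (sum-weights w total α) (-‿cong eq) ⟩
        α - α                                               ≈⟨ -‿inverseʳ α ⟩
        0#                                                  ∎) t)))

  indicator≤1 : ∀ b → indicator b ≤ 1#
  indicator≤1 true  = <-irrefl refl
  indicator≤1 false = <⇒≤ 0<1

  edgeCut : Bool → Bool → Bool → Carrier
  edgeCut a b c = indicator (a xor b) + indicator (a xor c) + indicator (b xor c)

  NAE⇒edgeCut≈2 : ∀ a b c → T (NAE₃ a b c) → edgeCut a b c ≈ 1# + 1#
  NAE⇒edgeCut≈2 true  true  false _ = +-congʳ (+-identityˡ 1#)
  NAE⇒edgeCut≈2 true  false true  _ = +-congʳ (+-identityʳ 1#)
  NAE⇒edgeCut≈2 true  false false _ = +-identityʳ _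
  NAE⇒edgeCut≈2 false true  true  _ = +-identityʳ _
  NAE⇒edgeCut≈2 false true  false _ = +-congʳ (+-identityʳ 1#)
  NAE⇒edgeCut≈2 false false true  _ = +-congʳ (+-identityˡ 1#)

  ¬NAE⇒edgeCut≈0 : ∀ a b c → ¬ T (NAE₃ a b c) → edgeCut a b c ≈ 0#
  ¬NAE⇒edgeCut≈0 true  true  true  _ = trans (+-identityʳ _) (+-identityʳ 0#)
  ¬NAE⇒edgeCut≈0 false false false _ = trans (+-identityʳ _) (+-identityʳ 0#)
  ¬NAE⇒edgeCut≈0 true  true  false n = contradiction tt n
  ¬NAE⇒edgeCut≈0 true  false true  n = contradiction tt n
  ¬NAE⇒edgeCut≈0 true  false false n = contradiction tt n
  ¬NAE⇒edgeCut≈0 false true  true  n = contradiction tt n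
  ¬NAE⇒edgeCut≈0 false true  false n = contradiction tt n
  ¬NAE⇒edgeCut≈0 false false true  n = contradiction tt n

  edgeCutAt : (Vertex n → Bool) → Pair< n → Carrier
  edgeCutAt S e = edgeCut (S (hyperedge e zero)) (S (hyperedge e (suc zero))) (S (hyperedge e (suc (suc zero))))

  ProperlyCuts⇒edgeCutAt≈2 : ∀ S e → ProperlyCuts S e → edgeCutAt S e ≈ 1# + 1#
  ProperlyCuts⇒edgeCutAt≈2 S e = NAE⇒edgeCut≈2 (S (hyperedge e zero)) (S (hyperedge e (suc zero))) (S (hyperedge e (suc (suc zero))))

  ¬ProperlyCuts⇒edgeCutAt≈0 : ∀ S e → ¬ ProperlyCuts S e → edgeCutAt S e ≈ 0#
  ¬ProperlyCuts⇒edgeCutAt≈0 S e = ¬NAE⇒edgeCut≈0 (S (hyperedge e zero)) (S (hyperedge e (suc zero))) (S (hyperedge e (suc (suc zero))))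

  edgeCutAt≤2 : ∀ S e → edgeCutAt S e ≤ 1# + 1#
  edgeCutAt≤2 S e with properlyCuts? S e
  ... | yes cuts = ≤-reflexive (ProperlyCuts⇒edgeCutAt≈2 S e cuts)
  ... | no ¬cuts = ≤-respˡ (sym (¬ProperlyCuts⇒edgeCutAt≈0 S e ¬cuts)) (+-nonneg (<⇒≤ 0<1) (<⇒≤ 0<1))

  weighted-edgeCutAt : ∀ {s} (w : Fin s → Carrier) (S : Fin s → Vertex n → Bool) e →
      sum (λ t → w t * δ (S t) (coveredPair (H n) (e , pair zero       (suc zero)       λ ())))
    + sum (λ t → w t * δ (S t) (coveredPair (H n) (e , pair zero       (suc (suc zero)) λ ())))
    + sum (λ t → w t * δ (S t) (coveredPair (H n) (e , pair (suc zero) (suc (suc zero)) λ ())))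
    ≈ sum (λ t → w t * edgeCutAt (S t) e)
  weighted-edgeCutAt w S e = begin
    sum (λ t → w t * A t) + sum (λ t → w t * B t) + sum (λ t → w t * C t)
      ≈⟨ +-congʳ (∑-distrib-+ (λ t → w t * A t) (λ t → w t * B t)) ⟨
    sum (λ t → w t * A t + w t * B t) + sum (λ t → w t * C t)
      ≈⟨ ∑-distrib-+ (λ t → w t * A t + w t * B t) (λ t → w t * C t) ⟨
    sum (λ t → w t * A t + w t * B t + w t * C t)
      ≈⟨ sum-cong-≋ (λ t → trans (distribˡ (w t) (A t + B t) (C t)) (+-congʳ (distribˡ (w t) (A t) (B t)))) ⟨
    sum (λ t → w t * edgeCutAt (S t) e) ∎
    where
    A B C : _ → Carrier
    A t = indicator (S t (hyperedge e zero) xor S t (hyperedge e (suc zero)))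
    B t = indicator (S t (hyperedge e zero) xor S t (hyperedge e (suc (suc zero))))
    C t = indicator (S t (hyperedge e (suc zero)) xor S t (hyperedge e (suc (suc zero))))

  cutOf : Hom I → Vertex n → Bool
  cutOf h v = Hom.value h (vertexVar v)

  lookup-scopeValues : ∀ h e k → Vec.lookup (scopeValues h e) (2 ↑ʳ k) ≡ cutOf h (hyperedge e k)
  lookup-scopeValues h e zero             = ≡.refl
  lookup-scopeValues h e (suc zero)       = ≡.refl
  lookup-scopeValues h e (suc (suc zero)) = ≡.refl

  project-Conv : ∀ {y} (y∈ : 𝓜sw ϑ (H n) y) → let open Conv y∈ in
    project ϑ (H n) y ≋ λ a → sum (λ t → weight t * δ (cutOf (pick t)) (coveredPair (H n) a))
  project-Conv {y} y∈ (e , pair k l _) = begin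
    readout q e y
      ≈⟨ eval-readoutᴬ q e y ⟨
    eval (readoutᴬ q e) y
      ≈⟨ eval-Conv (readoutᴬ q e) y∈ ⟩
    sum (λ t → weight t * eval (readoutᴬ q e) (marginalVector (pick t)))
      ≈⟨ sum-cong-≋ (λ t → *-congˡ (trans (eval-readoutᴬ-marginalVector q e (pick t))
           (reflexive (≡.cong indicator (≡.cong₂ _xor_ (lookup-scopeValues (pick t) e k) (lookup-scopeValues (pick t) e l)))))) ⟩
    sum (λ t → weight t * indicator (cutOf (pick t) (hyperedge e k) xor cutOf (pick t) (hyperedge e l))) ∎
    where
    open Conv y∈
    q : Vec Bool 5 → Bool
    q v = Vec.lookup v (2 ↑ʳ k) xor Vec.lookup v (2 ↑ʳ l)

  weightless : ∀ {w} → w * 0# ≈ w * 1# → w ≈ 0#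
  weightless {w} eq = trans (sym (*-identityʳ w)) (trans (sym eq) (zeroʳ w))

  weightless-cong : ∀ {w x y} → w ≈ 0# → w * x ≈ w * y
  weightless-cong w≈0 = trans (*-congʳ w≈0) (trans (zeroˡ _) (sym (trans (*-congʳ w≈0) (zeroˡ _))))

  face⇒cut : ∀ y → OpenGateFace ϑ (H n) y →
    ∃[ x ] ProperCutFace (H n) x × restrict (H n) x ≋ project ϑ (H n) y
  face⇒cut y (y∈ , r≈0 , z≈1) = x , (x∈ , proper) , λ a → sym (project-Conv y∈ a)
    where
    open Conv y∈
    S : Fin size → Vertex n → Bool
    S t = cutOf (pick t)
    x : Point (Pair (Vertex n))
    x a = sum (λ t → weight t * δ (S t) a)
    x∈ : CUT (Vertex n) x
    x∈ = record { weight = weight ; pick = S ; nonneg = nonneg ; total = total ; combination = λ _ → refl }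
    r-closed : ∀ t → _
    r-closed = attains-bound nonneg total (λ t → indicator≤1 _) (trans (sym (combination (singletonEvent gate-r _ false))) r≈0)
    z-closed : ∀ t → _
    z-closed = attains-bound nonneg total (λ t → indicator≤1 _) (trans (sym (combination (singletonEvent gate-z _ true))) z≈1)
    weighted-two : ∀ e t → weight t * edgeCutAt (S t) e ≈ weight t * (1# + 1#)
    -- Gate values other than r = 0, z = 1 force the weight to zero; in the remaining case the
    -- satisfied constraint reduces to `NAE₃`.
    weighted-two e t with Hom.value (pick t) gate-r in eq-r | Hom.value (pick t) gate-z in eq-z
                        | r-closed t | z-closed t | Hom.satisfies (pick t) e
    ... | true  | _     | w*0≈w*1 | _       | _   = weightless-cong (weightless w*0≈w*1)
    ... | false | false | _       | w*0≈w*1 | _   = weightless-cong (weightless w*0≈w*1)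
    ... | false | true  | _       | _       | nae = *-congˡ (ProperlyCuts⇒edgeCutAt≈2 (S t) e nae)
    proper : ∀ e → _
    proper e = trans (weighted-edgeCutAt weight S e)
      (trans (sum-cong-≋ (weighted-two e)) (sum-weights weight total (1# + 1#)))

  openGateHom : (S : Vertex n → Bool) → (∀ e → ProperlyCuts S e) → Hom I
  openGateHom S proper = record { value = assignment ; satisfies = proper }
    where
    assignment : SwitchVar (Vertex n) → Bool
    assignment gate-r        = false
    assignment gate-z        = true
    assignment (vertexVar v) = S v

  -- Every hyperedge has two original vertices and one auxiliary, so this cut is proper everywhere
  -- for each n.
  originalsVsAuxiliaries : Vertex n → Bool
  originalsVsAuxiliaries (u _) = false
  originalsVsAuxiliaries (z _) = true

  -- An improper cut turns out to have weight zero, but its term stays in the combination and still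
  -- needs an open-gate homomorphism; a fixed one is substituted.
  homOf : (Vertex n → Bool) → Hom I
  homOf S with allProperlyCut? S
  ... | yes proper = openGateHom S proper
  ... | no  _      = openGateHom originalsVsAuxiliaries (λ _ → tt)

  homOf-r : ∀ S → Hom.value (homOf S) gate-r ≡ false
  homOf-r S with allProperlyCut? S
  ... | yes _ = ≡.refl
  ... | no  _ = ≡.refl

  homOf-z : ∀ S → Hom.value (homOf S) gate-z ≡ true
  homOf-z S with allProperlyCut? S
  ... | yes _ = ≡.refl
  ... | no  _ = ≡.refl

  cut⇒face : ∀ x → ProperCutFace (H n) x →
    ∃[ y ] OpenGateFace ϑ (H n) y × project ϑ (H n) y ≋ restrict (H n) x
  cut⇒face x (x∈ , proper) = y , (y∈ , r≈0 , z≈1) , projects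
    where
    open Conv x∈ renaming (pick to S)
    y : Point (SwitchEvent ϑ (H n))
    y a = sum (λ t → weight t * marginalVector (homOf (S t)) a)
    y∈ : 𝓜sw ϑ (H n) y
    y∈ = record { weight = weight ; pick = homOf ∘ S ; nonneg = nonneg ; total = total ; combination = λ _ → refl }
    always : ∀ {f : Fin size → Bool} → (∀ t → f t ≡ true) → sum (λ t → weight t * indicator (f t)) ≈ 1#
    always f≡true = trans (sum-cong-≋ λ t → *-congˡ (reflexive (≡.cong indicator (f≡true t)))) (sum-weights weight total 1#)
    r≈0 : y (singletonEvent gate-r _ false) ≈ 1#
    r≈0 = always λ t → ≡.cong (λ b → does (b Bool.≟ false)) (homOf-r (S t))
    z≈1 : y (singletonEvent gate-z _ true) ≈ 1#
    z≈1 = always λ t → ≡.cong (λ b → does (b Bool.≟ true)) (homOf-z (S t))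
    weighted-two : ∀ e t → weight t * edgeCutAt (S t) e ≈ weight t * (1# + 1#)
    weighted-two e = attains-bound nonneg total (λ t → edgeCutAt≤2 (S t) e) (begin
      sum (λ t → weight t * edgeCutAt (S t) e)   ≈⟨ weighted-edgeCutAt weight S e ⟨
      _                                          ≈⟨ +-cong (+-cong (combination _) (combination _)) (combination _) ⟨
      _                                          ≈⟨ proper e ⟩
      1# + 1#                                    ∎)
    improper⇒weightless : ∀ t → ¬ (∀ e → ProperlyCuts (S t) e) → weight t ≈ 0#
    improper⇒weightless t improper = ≈-stable λ w≉0 → improper (cuts w≉0)
      where
      cuts : ¬ weight t ≈ 0# → ∀ e → ProperlyCuts (S t) e
      cuts w≉0 e with properlyCuts? (S t) e
      ... | yes cuts = cuts
      -- The edge cut is 0 at an improper hyperedge although the combination attains the maximum 2,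
      -- so twice the weight is zero.
      ... | no ¬cuts = contradiction (x+y≈0⇒x≈0 (nonneg t) (nonneg t) (begin
        weight t + weight t             ≈⟨ +-cong (*-identityʳ _) (*-identityʳ _) ⟨
        weight t * 1# + weight t * 1#   ≈⟨ distribˡ _ _ _ ⟨
        weight t * (1# + 1#)            ≈⟨ weighted-two e t ⟨
        weight t * edgeCutAt (S t) e    ≈⟨ *-congˡ (¬ProperlyCuts⇒edgeCutAt≈0 (S t) e ¬cuts) ⟩
        weight t * 0#                   ≈⟨ zeroʳ _ ⟩
        0#                              ∎)) w≉0
    same-cut : ∀ t a → weight t * δ (cutOf (homOf (S t))) a ≈ weight t * δ (S t) a
    same-cut t (pair v w _) with allProperlyCut? (S t)
    ... | yes _       = refl
    ... | no improper = weightless-cong (improper⇒weightless t improper)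
    projects : project ϑ (H n) y ≋ restrict (H n) x
    projects a = trans (project-Conv y∈ a)
      (trans (sum-cong-≋ λ t → same-cut t (coveredPair (H n) a)) (sym (combination (coveredPair (H n) a))))

open import Data.Nat using (_+_; _*_; _^_; _≤_; suc)

theorem8p4 : ∀ {c ℓ₁ ℓ₂ ℓ₃} (𝔽 : OrderedField c ℓ₁ ℓ₂ ℓ₃) (ϑ : ℚ) → 0ℚ <ℚ ϑ → ϑ <ℚ 1ℚ →
    let open Geometry 𝔽 in
    ∃[ N ] (∀ n → Vertex n ↔ Fin (N n))
    × IsΘ N (λ n → n * n)
    × (∀ n → 2 ≤ n →
    (∀ y → OpenGateFace ϑ (H n) y → ∃[ x ] ProperCutFace (H n) x × restrict (H n) x ≋ project ϑ (H n) y)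
    × (∀ x → ProperCutFace (H n) x → ∃[ y ] OpenGateFace ϑ (H n) y × project ϑ (H n) y ≋ restrict (H n) x))
    × (∃[ d ] ∃[ n₀ ] (∀ n → 2 ≤ n → n₀ ≤ n → ∀ k → Extension (𝓜sw ϑ (H n)) k → 2 ^ n ≤ k ^ d))
    × (∃[ d ] ∃[ n₀ ] (∀ n → 2 ≤ n → n₀ ≤ n → ∀ k → Extension (𝓜sw ϑ (H n)) k → 2^√ N n ≤ (k ^ d)))
    × (∀ (W : (I : Instance (switchTemplate ϑ)) → Instance.Var I → Bool) →
    ¬ (∃[ C ] ∃[ d ] (∀ (I : Instance (switchTemplate ϑ)) (v m : ℕ) →
    Instance.Var I ↔ Fin v → Instance.Con I ↔ Fin m →
    ∃[ k ] Extension (Marginal I (W I)) k × k ≤ C * suc (v + m) ^ d)))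
theorem8p4 𝔽 ϑ _ _ =
    #vertices
  , Vertex↔Fin
  , #vertices-Θ
  , (λ n _ → FaceProjection.face⇒cut 𝔽 ϑ n , FaceProjection.cut⇒face 𝔽 ϑ n)
  , (4 , 0 , λ n 2≤n _ k → xc-bound n isGate 2≤n)
  , (4 , 0 , λ n 2≤n _ k ext → 2^√-bound n (k ^ 4) (#vertices≤n*n n) (xc-bound n isGate 2≤n ext))
  , λ W (C , d , compact) →
      let n , 2≤n , large = exponential-beats-polynomial C d 4
          -- The variables are the two gates and the vertices, the constraints the pairs; the size
          -- of a formulation supposed compact is then too small for `xc-bound`.
          k , ext , k≤    = compact (switchInstance ϑ (H n)) (2 + #vertices n) (#pairs n)
                                    (SwitchVar↔Fin (Vertex↔Fin n)) (Pair<↔Fin n)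
      in ℕ.<⇒≱ large (ℕ.≤-trans (xc-bound n (W _) 2≤n ext) (ℕ.^-monoˡ-≤ 4 k≤))
  where
  open Geometry 𝔽
  -- One vertex of U is the auxiliary 0 of the squares, so disjointness is used over one element
  -- fewer; 2 ≤ n keeps that number positive, as `2^-bound` requires.
  xc-bound : ∀ n W → 2 ≤ n → ∀ {k} → Extension (Marginal (switchInstance ϑ (H n)) W) k → 2 ^ n ≤ k ^ 4
  xc-bound (suc n) W (ℕ.s≤s 1≤n) {k} ext =
    2^-bound n k 1≤n (SwitchPolytope.Marginal-bound 𝔽 ϑ n W ext)
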